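{- A minimal set $A\subset\mathbb{Z}^2$ is connected (i.e. the subgraph of $X$ induced on $A$ is connected) if and only if $A$ is not congruent to $B(0,2)=\{(x,y): y=x,\ 0\le 2x\le 2\}=\{(0,0),(1,1)\}$.
   Context: $X$ is the graph with vertex set $\mathbb{Z}^2$ in which $(x,y)$ and $(x',y')$ are adjacent iff $|x-x'|+|y-y'|=1$. For $A\subset\mathbb{Z}^2$, $\partial A=\{u\in\mathbb{Z}^2\setminus A:\ u \text{ adjacent to some } v\in A\}$. A finite nonempty set $A$ is minimal if $|\partial A|\le|\partial C|$ for all $C$ with $|C|=|A|$. Two sets are congruent if some graph automorphism of $X$ maps one onto the other. $B(\alpha,\beta)=\{(x,y): 0\le y-x\le\alpha,\ 0\le y+x\le\beta\}$. -}

module Defs where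

open import Data.Nat using (ℕ; _≤_)
open import Data.Integer as ℤ using (ℤ; +_; _-_; ∣_∣)
import Data.Integer.Properties as ℤP
open import Data.Product using (_×_; _,_; ∃; ∃-syntax; Σ-syntax)
open import Data.Product.Properties using (≡-dec)
open import Data.List using (List; []; _∷_; length; filter; deduplicate; concatMap)
open import Data.List.Relation.Unary.Unique.Propositional using (Unique)
open import Data.List.Membership.Propositional using (_∈_; _∉_)
open import Relation.Binary.PropositionalEquality using (_≡_)
open import Relation.Binary.Definitions using (DecidableEquality)
open import Relation.Nullary using (¬_; ¬?)
open import Function.Definitions using (Bijective)
open import Function.Bundles using (_⇔_)

Pt : Set
Pt = ℤ × ℤ

_≟P_ : DecidableEquality Pt
_≟P_ = ≡-dec ℤP._≟_ ℤP._≟_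

open import Data.List.Membership.DecPropositional _≟P_ using (_∈?_)

Adj : Pt → Pt → Set
Adj (x , y) (x' , y') = ∣ x - x' ∣ Data.Nat.+ ∣ y - y' ∣ ≡ 1

neighbours : Pt → List Pt
neighbours (x , y) =
  (x ℤ.+ + 1 , y) ∷ (x - + 1 , y) ∷ (x , y ℤ.+ + 1) ∷ (x , y - + 1) ∷ []

-- Finite sets are represented by duplicate-free lists (Unique).
-- ∂A as a duplicate-free list: neighbours of points of A that lie outside A.
boundary : List Pt → List Pt
boundary A = deduplicate _≟P_ (filter (λ u → ¬? (u ∈? A)) (concatMap neighbours A))

Minimal : List Pt → Set
Minimal A = (A ≡ [] → Data.Empty.⊥) × Unique A ×
  ((C : List Pt) → Unique C → length C ≡ length A →
     length (boundary A) ≤ length (boundary C))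
  where import Data.Empty

data PathIn (A : List Pt) : Pt → Pt → Set where
  here : ∀ {u} → PathIn A u u
  step : ∀ {u w v} → Adj u w → w ∈ A → PathIn A w v → PathIn A u v

Connected : List Pt → Set
Connected A = ∀ u v → u ∈ A → v ∈ A → PathIn A u v

IsAutomorphism : (Pt → Pt) → Set
IsAutomorphism f = Bijective _≡_ _≡_ f × (∀ u v → Adj u v ⇔ Adj (f u) (f v))

MapsOnto : (Pt → Pt) → List Pt → List Pt → Set
MapsOnto f A B = (∀ a → a ∈ A → f a ∈ B) × (∀ b → b ∈ B → ∃[ a ] (a ∈ A × f a ≡ b))

Congruent : List Pt → List Pt → Set
Congruent A B = ∃[ f ] (IsAutomorphism f × MapsOnto f A B)

B02 : List Pt
B02 = (+ 0 , + 0) ∷ (+ 1 , + 1) ∷ []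

{-# OPTIONS --safe #-}
module Submission where

-- Call {y - x = r} the r-th row. Let e be the number of points p of A with p + (1 , 1) ∉ A (at least
-- one per nonempty row) and let m be the largest size of a row. Shifting the rows up to some threshold
-- one row down and the others one row up, together with the extra point that each interval gains in
-- this way, places |A| + e points in A ∪ ∂A and leaves the rows at the threshold free. Chosen at a
-- largest row, these contain 2m + 1 further points, or 2m + 2 if the next row is as large. A diamond
-- with e rows has room for |A| points and exactly that boundary, so for minimal A the points found
-- exhaust A ∪ ∂A. Hence every point has a neighbour in the adjacent row towards the peak row, and the
-- peak row is an interval. The only exception is a gap between two largest rows, which forces A to be
-- a diagonal pair. The same holds for the columns {y + x = s}, by reflection; they connect consecutive
-- points of the peak row.

open import Defs
open import Algebra.Bundles using (module AbelianGroup)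
open import Data.Nat as ℕ using (ℕ; zero; suc; _+_; _*_; _≤_; _<_; z≤n; s≤s)
import Data.Nat.Properties as ℕP
import Data.Nat.Tactic.RingSolver as ℕSolver
open import Data.Integer as ℤ using (ℤ; +_; -_; _-_; ∣_∣)
import Data.Integer.Properties as ℤP
open import Data.Integer.Tactic.RingSolver using (solve-∀)
open import Algebra.Properties.Group (AbelianGroup.group ℤP.+-0-abelianGroup) using (∙-cancelʳ)
open import Data.Product using (_×_; _,_; ∃-syntax; proj₁; proj₂)
open import Data.Product.Properties using (,-injective)
open import Data.Sum using (_⊎_; inj₁; inj₂; [_,_]′)
open import Data.List using (List; []; _∷_; _++_; length; map; filter; upTo; concatMap; cartesianProductWith)
import Data.List.Properties as LP
open import Data.List.Membership.Propositional using (_∈_; _∉_; find; lose)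
open import Data.List.Membership.Propositional.Properties
open import Data.List.Membership.DecPropositional _≟P_ using (_∈?_)
open import Data.List.Relation.Unary.Any as Any using (here; there)
open import Data.List.Relation.Unary.All as All using ()
import Data.List.Relation.Unary.All.Properties as AllP
open import Data.List.Relation.Unary.AllPairs using ([]; _∷_)
open import Data.List.Relation.Unary.Unique.Propositional using (Unique)
import Data.List.Relation.Unary.Unique.Propositional.Properties as UP
import Data.List.Relation.Unary.Unique.DecPropositional.Properties _≟P_ as UDP
open import Data.List.Relation.Binary.Subset.Propositional using (_⊆_)
import Data.List.Extrema ℤP.≤-totalOrder as Ex
open import Function.Base using (_∘_; id)
open import Function.Bundles using (_⇔_; mk⇔; Equivalence)
open import Level using (0ℓ)
open import Relation.Binary.PropositionalEquality
open import Relation.Nullary using (¬_; Dec; yes; no; ¬?; contradiction)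
open import Relation.Nullary.Decidable using (_×-dec_)
open import Relation.Unary using (Pred; Decidable)

-- Counting in duplicate-free lists, and the set A ∪ ∂A.

unique-⊆⇒length≤ : {A : Set} {xs ys : List A} → Unique xs → xs ⊆ ys → length xs ≤ length ys
unique-⊆⇒length≤ [] _ = z≤n
unique-⊆⇒length≤ {xs = x ∷ xs} (x∉ ∷ u) sub with ∈-∃++ (sub (here refl))
... | as , bs , refl = begin
  suc (length xs)              ≤⟨ s≤s (unique-⊆⇒length≤ u sub′) ⟩
  suc (length (as ++ bs))      ≡⟨ cong suc (LP.length-++ as) ⟩
  suc (length as + length bs)  ≡⟨ ℕP.+-suc (length as) (length bs) ⟨
  length as + suc (length bs)  ≡⟨ LP.length-++ as ⟨
  length (as ++ x ∷ bs)        ∎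
  where
  open ℕP.≤-Reasoning
  sub′ : xs ⊆ as ++ bs
  sub′ z∈ with ∈-++⁻ as (sub (there z∈))
  ... | inj₁ z∈as = ∈-++⁺ˡ z∈as
  ... | inj₂ (there z∈bs) = ∈-++⁺ʳ as z∈bs
  ... | inj₂ (here refl) = contradiction refl (All.lookup x∉ z∈)

-- The equality case of the pigeonhole principle. Through it a sharp bound for the boundary becomes
-- a description of all points of `closure A`.
unique-⊆-length≥⇒⊇ : {xs ys : List Pt} → Unique xs → xs ⊆ ys → length ys ≤ length xs → ys ⊆ xs
unique-⊆-length≥⇒⊇ {xs} u sub le {y} y∈ with y ∈? xs
... | yes y∈xs = y∈xs
... | no y∉xs = contradiction (ℕP.≤-trans longer le) ℕP.1+n≰n
  where
  longer = unique-⊆⇒length≤ (AllP.¬Any⇒All¬ xs y∉xs ∷ u) λ { (here refl) → y∈ ; (there z∈) → sub z∈ }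

-- Boundary sizes are compared through A ∪ ∂A, which has |A| + |∂A| points. It contains every
-- neighbour of `A`, so mapping points into it requires no distinction whether they lie in `A`.
closure : List Pt → List Pt
closure A = A ++ boundary A

∈-closure⁻ : ∀ A {p} → p ∈ closure A → p ∈ A ⊎ ∃[ a ] (a ∈ A × p ∈ neighbours a)
∈-closure⁻ A p∈ with ∈-++⁻ A p∈
... | inj₁ p∈A = inj₁ p∈A
... | inj₂ p∈∂ = inj₂ (find (∈-concatMap⁻ neighbours {xs = A}
                  (proj₁ (∈-filter⁻ (λ u → ¬? (u ∈? A)) (∈-deduplicate⁻ _≟P_ _ p∈∂)))))

neighbours⊆closure : ∀ {A a} → a ∈ A → neighbours a ⊆ closure A
neighbours⊆closure {A} {a} a∈ {p} p∈ with p ∈? A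
... | yes p∈A = ∈-++⁺ˡ p∈A
... | no p∉A = ∈-++⁺ʳ A (∈-deduplicate⁺ _≟P_ (∈-filter⁺ (λ u → ¬? (u ∈? A))
                 (∈-concatMap⁺ neighbours (lose a∈ p∈)) p∉A))

closure-unique : ∀ {A} → Unique A → Unique (closure A)
closure-unique {A} u = UP.++⁺ u (UDP.deduplicate-! _) λ (p∈A , p∈∂) →
  proj₂ (∈-filter⁻ (λ u → ¬? (u ∈? A)) {xs = concatMap neighbours A} (∈-deduplicate⁻ _≟P_ _ p∈∂)) p∈A

length-closure : ∀ A → length (closure A) ≡ length A + length (boundary A)
length-closure A = LP.length-++ A

-- Minimal boundaries are monotone in the number of points.

maximiser : ∀ (f : Pt → ℤ) {A z} → z ∈ A → ∃[ p ] (p ∈ A × ∀ {q} → q ∈ A → f q ℤ.≤ f p)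
maximiser f {A} {z} z∈ = Ex.argmax f z A , Ex.argmax-all f z∈ (All.tabulate id) ,
  All.lookup (Ex.f[xs]≤f[argmax] z A)

i<i+1 : ∀ i → i ℤ.< i ℤ.+ + 1
i<i+1 i = ℤP.suc[i]≤j⇒i<j (ℤP.≤-reflexive (ℤP.+-comm (+ 1) i))

i-1<i : ∀ i → i - + 1 ℤ.< i
i-1<i i = subst (i - + 1 ℤ.<_) (eq i) (i<i+1 (i - + 1))
  where
  eq : ∀ i → i - + 1 ℤ.+ + 1 ≡ i
  eq = solve-∀

-- Removing a point z of largest abscissa also removes its right neighbour from the closure.
shrink : ∀ {C z} → Unique C → z ∈ C →
         ∃[ C′ ] (Unique C′ × suc (length C′) ≡ length C × length (boundary C′) ≤ length (boundary C))
shrink {C} u z∈ with maximiser proj₁ z∈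
... | z , z∈C , max = C′ , u′ , size , ℕP.+-cancelˡ-≤ (length C) _ _ (begin
    length C + length (boundary C′)        ≡⟨ cong (_+ length (boundary C′)) size ⟨
    suc (length C′ + length (boundary C′)) ≡⟨ cong suc (length-closure C′) ⟨
    suc (length (closure C′))              ≤⟨ unique-⊆⇒length≤ (AllP.¬Any⇒All¬ _ r∉ ∷ closure-unique u′) sub ⟩
    length (closure C)                     ≡⟨ length-closure C ⟩
    length C + length (boundary C)         ∎)
  where
  open ℕP.≤-Reasoning
  ≢z? = λ p → ¬? (p ≟P z)
  C′ = filter ≢z? C
  u′ = UP.filter⁺ ≢z? u
  C′⊆C : C′ ⊆ C
  C′⊆C p∈ = proj₁ (∈-filter⁻ ≢z? p∈)
  z∉C′ : z ∉ C′
  z∉C′ z∈C′ = proj₂ (∈-filter⁻ ≢z? {xs = C} z∈C′) refl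
  size : suc (length C′) ≡ length C
  size = ℕP.≤-antisym
    (unique-⊆⇒length≤ (AllP.¬Any⇒All¬ _ z∉C′ ∷ u′) λ { (here refl) → z∈C ; (there p∈) → C′⊆C p∈ })
    (unique-⊆⇒length≤ u λ {p} p∈ → case p p∈)
    where
    case : ∀ p → p ∈ C → p ∈ z ∷ C′
    case p p∈ with p ≟P z
    ... | yes refl = here refl
    ... | no p≢z = there (∈-filter⁺ ≢z? p∈ p≢z)
  r = (proj₁ z ℤ.+ + 1 , proj₂ z)
  right : ∀ {p} → p ∈ C → ¬ (proj₁ z ℤ.< proj₁ p)
  right p∈ lt = ℤP.<⇒≱ lt (max p∈)
  far : ∀ a → a ∈ C′ → r ∉ neighbours a
  far (x , y) a∈ (here eq) = z∉C′ (subst (_∈ C′) (sym (cong₂ _,_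
    (∙-cancelʳ (+ 1) _ _ (proj₁ (,-injective eq))) (proj₂ (,-injective eq)))) a∈)
  far (x , y) a∈ (there (here eq)) = right (C′⊆C a∈)
    (ℤP.<-trans (i<i+1 _) (subst (ℤ._< x) (sym (proj₁ (,-injective eq))) (i-1<i x)))
  far (x , y) a∈ (there (there (here eq))) = right (C′⊆C a∈) (subst (proj₁ z ℤ.<_) (proj₁ (,-injective eq)) (i<i+1 _))
  far (x , y) a∈ (there (there (there (here eq)))) = right (C′⊆C a∈) (subst (proj₁ z ℤ.<_) (proj₁ (,-injective eq)) (i<i+1 _))
  r∉ : r ∉ closure C′
  r∉ r∈ with ∈-closure⁻ C′ r∈
  ... | inj₁ r∈C′ = right (C′⊆C r∈C′) (i<i+1 _)
  ... | inj₂ (a , a∈ , r∈a) = far a a∈ r∈a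
  sub : r ∷ closure C′ ⊆ closure C
  sub (here refl) = neighbours⊆closure z∈C (here refl)
  sub (there p∈) with ∈-closure⁻ C′ p∈
  ... | inj₁ p∈C′ = ∈-++⁺ˡ (C′⊆C p∈C′)
  ... | inj₂ (a , a∈ , p∈a) = neighbours⊆closure (C′⊆C a∈) p∈a

-- Minimality compares sets of equal size only. The surplus points of `C`, `d` in number, are
-- removed one at a time by `shrink`, which never enlarges the boundary.
minimal⇒boundary≤ : ∀ {A C} → Minimal A → Unique C → length A ≤ length C → length (boundary A) ≤ length (boundary C)
minimal⇒boundary≤ {A} min u le = go _ u (ℕP.m≤n⇒∃[o]m+o≡n le .proj₂)
  where
  go : ∀ d {C} → Unique C → length A + d ≡ length C → length (boundary A) ≤ length (boundary C)
  go zero u eq = proj₂ (proj₂ min) _ u (trans (sym eq) (ℕP.+-identityʳ _))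
  go (suc d) {C = []} u eq = contradiction (trans (sym (ℕP.+-suc _ d)) eq) λ ()
  go (suc d) {C = z ∷ C} u eq =
    let C′ , u′ , size , le′ = shrink u (here refl)
        eq′ = trans (sym (ℕP.+-suc _ d)) (trans eq (sym size))
    in ℕP.≤-trans (go d u′ (ℕP.suc-injective eq′)) le′

-- Diamonds as comparison sets.

-- In the rotated coordinates (y - x , y + x) these are (2i , 2j) and (2i - 1 , 2j - 1). A unit step
-- changes both coordinates by 1 or -1, hence switches between even and odd points.
evenPt oddPt : ℕ → ℕ → Pt
evenPt i j = + j - + i , + i ℤ.+ + j
oddPt i j = + j - + i , + i ℤ.+ + j - + 1

grid : (ℕ → ℕ → Pt) → ℕ → ℕ → List Pt
grid f h k = cartesianProductWith f (upTo h) (upTo k)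

∈-grid⁺ : ∀ f {h k i j} → i < h → j < k → f i j ∈ grid f h k
∈-grid⁺ f i<h j<k = ∈-cartesianProductWith⁺ f (∈-upTo⁺ i<h) (∈-upTo⁺ j<k)

∈-grid⁻ : ∀ f h k {p} → p ∈ grid f h k → ∃[ i ] ∃[ j ] (i < h × j < k × p ≡ f i j)
∈-grid⁻ f h k p∈ with ∈-cartesianProductWith⁻ f (upTo h) (upTo k) p∈
... | i , j , i∈ , j∈ , eq = i , j , ∈-upTo⁻ i∈ , ∈-upTo⁻ j∈ , eq

length-cartesianProductWith : {A B C : Set} (f : A → B → C) (xs : List A) (ys : List B) →
  length (cartesianProductWith f xs ys) ≡ length xs * length ys
length-cartesianProductWith f [] ys = refl
length-cartesianProductWith f (x ∷ xs) ys = trans (LP.length-++ (map (f x) ys))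
  (cong₂ _+_ (LP.length-map (f x) ys) (length-cartesianProductWith f xs ys))

length-grid : ∀ f h k → length (grid f h k) ≡ h * k
length-grid f h k = trans (length-cartesianProductWith f (upTo h) (upTo k))
  (cong₂ _*_ (LP.length-upTo h) (LP.length-upTo k))

evenPt-sum : ∀ i j → let (x , y) = evenPt i j in x ℤ.+ y ≡ + (2 * j)
evenPt-sum i j = trans (eq (+ i) (+ j)) (sym (ℤP.pos-* 2 j))
  where
  eq : ∀ i j → j - i ℤ.+ (i ℤ.+ j) ≡ + 2 ℤ.* j
  eq = solve-∀

evenPt-diff : ∀ i j → let (x , y) = evenPt i j in y - x ≡ + (2 * i)
evenPt-diff i j = trans (eq (+ i) (+ j)) (sym (ℤP.pos-* 2 i))
  where
  eq : ∀ i j → i ℤ.+ j - (j - i) ≡ + 2 ℤ.* i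
  eq = solve-∀

evenPt-injective : ∀ {i i′ j j′} → evenPt i j ≡ evenPt i′ j′ → i ≡ i′ × j ≡ j′
evenPt-injective {i} {i′} {j} {j′} eq =
  half (trans (sym (evenPt-diff i j)) (trans (cong (λ (x , y) → y - x) eq) (evenPt-diff i′ j′))) ,
  half (trans (sym (evenPt-sum i j)) (trans (cong (λ (x , y) → x ℤ.+ y) eq) (evenPt-sum i′ j′)))
  where
  half : ∀ {a b} → + (2 * a) ≡ + (2 * b) → a ≡ b
  half e = ℕP.*-cancelˡ-≡ _ _ 2 (ℤP.+-injective e)

-- The rotated coordinates are (2i + 1 , 2j + 1): this is the centre of the cell of even points
-- whose lowest corner has indices i and j.
innerPt : ℕ → ℕ → Pt
innerPt i j = oddPt (suc i) (suc j)

innerPt≡ : ∀ i j → innerPt i j ≡ (+ j - + i , + i ℤ.+ + j ℤ.+ + 1)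
innerPt≡ i j = cong₂ _,_ (e₁ (+ i) (+ j)) (e₂ (+ i) (+ j))
  where
  e₁ : ∀ i j → + 1 ℤ.+ j - (+ 1 ℤ.+ i) ≡ j - i
  e₁ = solve-∀
  e₂ : ∀ i j → + 1 ℤ.+ i ℤ.+ (+ 1 ℤ.+ j) - + 1 ≡ i ℤ.+ j ℤ.+ + 1
  e₂ = solve-∀

innerPt-injective : ∀ {i i′ j j′} → innerPt i j ≡ innerPt i′ j′ → i ≡ i′ × j ≡ j′
innerPt-injective {i} {i′} {j} {j′} eq = evenPt-injective (cong₂ _,_
    (proj₁ (,-injective eq′)) (∙-cancelʳ (+ 1) _ _ (proj₂ (,-injective eq′))))
  where eq′ = trans (sym (innerPt≡ i j)) (trans eq (innerPt≡ i′ j′))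

evenPt≢innerPt : ∀ {i i′ j j′} → evenPt i j ≢ innerPt i′ j′
evenPt≢innerPt {i} {i′} {j} {j′} eq = ℕP.even≢odd j j′ (ℤP.+-injective (begin
  + (2 * j)                                     ≡⟨ evenPt-sum i j ⟨
  + j - + i ℤ.+ (+ i ℤ.+ + j)                   ≡⟨ cong (λ (x , y) → x ℤ.+ y) (trans eq (innerPt≡ i′ j′)) ⟩
  + j′ - + i′ ℤ.+ (+ i′ ℤ.+ + j′ ℤ.+ + 1)       ≡⟨ assoc (+ j′ - + i′) (+ i′ ℤ.+ + j′) ⟩
  + 1 ℤ.+ (+ j′ - + i′ ℤ.+ (+ i′ ℤ.+ + j′))     ≡⟨ cong (λ s → + 1 ℤ.+ s) (evenPt-sum i′ j′) ⟩
  + suc (2 * j′)                                ∎))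
  where
  open ≡-Reasoning
  assoc : ∀ a b → a ℤ.+ (b ℤ.+ + 1) ≡ + 1 ℤ.+ (a ℤ.+ b)
  assoc = solve-∀

-- The point (i , j) of the even grid is adjacent to the corners (i , j), …, (i + 1 , j + 1) of
-- the odd one, and vice versa (shifted by one), so the closure is again a union of two grids.
minimal⇒boundary≤diamond : ∀ {A} → Minimal A → ∀ {h h′ k k′} →
  h ≤ suc h′ → k ≤ suc k′ → h′ ≤ h → k′ ≤ k →
  length A ≤ h * k + h′ * k′ → length (boundary A) ≤ suc h + suc h′ + (k + k′)
minimal⇒boundary≤diamond {A} min {h} {h′} {k} {k′} h≤ k≤ h′≤ k′≤ le = ℕP.≤-trans
  (minimal⇒boundary≤ min uD (ℕP.≤-trans le (ℕP.≤-reflexive (sym lenD))))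
  (ℕP.+-cancelˡ-≤ (length D) _ _ (begin
    length D + length (boundary D)                     ≡⟨ length-closure D ⟨
    length (closure D)                                 ≤⟨ unique-⊆⇒length≤ (closure-unique uD) sub ⟩
    length Y                                           ≡⟨ lenY ⟩
    suc h * suc k + suc h′ * suc k′                    ≡⟨ arith h h′ k k′ ⟩
    h * k + h′ * k′ + (suc h + suc h′ + (k + k′))      ≡⟨ cong (_+ (suc h + suc h′ + (k + k′))) lenD ⟨
    length D + (suc h + suc h′ + (k + k′))             ∎))
  where
  open ℕP.≤-Reasoning
  arith : ∀ h h′ k k′ → suc h * suc k + suc h′ * suc k′ ≡ h * k + h′ * k′ + (suc h + suc h′ + (k + k′))
  arith = ℕSolver.solve-∀
  -- `D` alternates `h` rows of `k` points with `h′` rows of `k′` points. The four inequalities on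
  -- the side lengths ensure that `D` itself lies in `Y`, not only its neighbours.
  D = grid evenPt h k ++ grid innerPt h′ k′
  Y = grid oddPt (suc h) (suc k) ++ grid evenPt (suc h′) (suc k′)
  lenD : length D ≡ h * k + h′ * k′
  lenD = trans (LP.length-++ (grid evenPt h k)) (cong₂ _+_ (length-grid evenPt h k) (length-grid innerPt h′ k′))
  lenY : length Y ≡ suc h * suc k + suc h′ * suc k′
  lenY = trans (LP.length-++ (grid oddPt (suc h) (suc k)))
    (cong₂ _+_ (length-grid oddPt (suc h) (suc k)) (length-grid evenPt (suc h′) (suc k′)))
  uD : Unique D
  uD = UP.++⁺ (UP.cartesianProductWith⁺ evenPt evenPt-injective (UP.upTo⁺ h) (UP.upTo⁺ k))
              (UP.cartesianProductWith⁺ innerPt innerPt-injective (UP.upTo⁺ h′) (UP.upTo⁺ k′)) disj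
    where
    disj : ∀ {p} → ¬ (p ∈ grid evenPt h k × p ∈ grid innerPt h′ k′)
    disj (p∈ , p∈′) with ∈-grid⁻ evenPt h k p∈ | ∈-grid⁻ innerPt h′ k′ p∈′
    ... | i , j , _ , _ , refl | i′ , j′ , _ , _ , eq = evenPt≢innerPt {i} {i′} {j} {j′} eq
  odd∈ : ∀ i j → i < suc h → j < suc k → ∀ {p} → p ≡ oddPt i j → p ∈ Y
  odd∈ i j i< j< refl = ∈-++⁺ˡ (∈-grid⁺ oddPt i< j<)
  even∈ : ∀ i j → i < suc h′ → j < suc k′ → ∀ {p} → p ≡ evenPt i j → p ∈ Y
  even∈ i j i< j< refl = ∈-++⁺ʳ (grid oddPt (suc h) (suc k)) (∈-grid⁺ evenPt i< j<)
  nbrE : ∀ i j → i < h → j < k → neighbours (evenPt i j) ⊆ Y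
  nbrE i j i< j< (here refl) = odd∈ i (suc j) (ℕP.m<n⇒m<1+n i<) (s≤s j<) (cong₂ _,_ (e₁ (+ i) (+ j)) (e₂ (+ i) (+ j)))
    where
    e₁ : ∀ i j → j - i ℤ.+ + 1 ≡ + 1 ℤ.+ j - i
    e₁ = solve-∀
    e₂ : ∀ i j → i ℤ.+ j ≡ i ℤ.+ (+ 1 ℤ.+ j) - + 1
    e₂ = solve-∀
  nbrE i j i< j< (there (here refl)) = odd∈ (suc i) j (s≤s i<) (ℕP.m<n⇒m<1+n j<) (cong₂ _,_ (e₁ (+ i) (+ j)) (e₂ (+ i) (+ j)))
    where
    e₁ : ∀ i j → j - i - + 1 ≡ j - (+ 1 ℤ.+ i)
    e₁ = solve-∀
    e₂ : ∀ i j → i ℤ.+ j ≡ + 1 ℤ.+ i ℤ.+ j - + 1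
    e₂ = solve-∀
  nbrE i j i< j< (there (there (here refl))) = odd∈ (suc i) (suc j) (s≤s i<) (s≤s j<) (sym (innerPt≡ i j))
  nbrE i j i< j< (there (there (there (here refl)))) = odd∈ i j (ℕP.m<n⇒m<1+n i<) (ℕP.m<n⇒m<1+n j<) refl
  nbrO : ∀ i j → i < h′ → j < k′ → neighbours (+ j - + i , + i ℤ.+ + j ℤ.+ + 1) ⊆ Y
  nbrO i j i< j< (here refl) = even∈ i (suc j) (ℕP.m<n⇒m<1+n i<) (s≤s j<) (cong₂ _,_ (e₁ (+ i) (+ j)) (e₂ (+ i) (+ j)))
    where
    e₁ : ∀ i j → j - i ℤ.+ + 1 ≡ + 1 ℤ.+ j - i
    e₁ = solve-∀
    e₂ : ∀ i j → i ℤ.+ j ℤ.+ + 1 ≡ i ℤ.+ (+ 1 ℤ.+ j)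
    e₂ = solve-∀
  nbrO i j i< j< (there (here refl)) = even∈ (suc i) j (s≤s i<) (ℕP.m<n⇒m<1+n j<) (cong₂ _,_ (e₁ (+ i) (+ j)) (e₂ (+ i) (+ j)))
    where
    e₁ : ∀ i j → j - i - + 1 ≡ j - (+ 1 ℤ.+ i)
    e₁ = solve-∀
    e₂ : ∀ i j → i ℤ.+ j ℤ.+ + 1 ≡ + 1 ℤ.+ i ℤ.+ j
    e₂ = solve-∀
  nbrO i j i< j< (there (there (here refl))) = even∈ (suc i) (suc j) (s≤s i<) (s≤s j<) (cong₂ _,_ (e₁ (+ i) (+ j)) (e₂ (+ i) (+ j)))
    where
    e₁ : ∀ i j → j - i ≡ + 1 ℤ.+ j - (+ 1 ℤ.+ i)
    e₁ = solve-∀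
    e₂ : ∀ i j → i ℤ.+ j ℤ.+ + 1 ℤ.+ + 1 ≡ + 1 ℤ.+ i ℤ.+ (+ 1 ℤ.+ j)
    e₂ = solve-∀
  nbrO i j i< j< (there (there (there (here refl)))) = even∈ i j (ℕP.m<n⇒m<1+n i<) (ℕP.m<n⇒m<1+n j<) (cong (+ j - + i ,_) (e (+ i) (+ j)))
    where
    e : ∀ i j → i ℤ.+ j ℤ.+ + 1 - + 1 ≡ i ℤ.+ j
    e = solve-∀
  sub : closure D ⊆ Y
  sub p∈ with ∈-closure⁻ D p∈
  ... | inj₁ p∈D with ∈-++⁻ (grid evenPt h k) p∈D
  ...   | inj₁ p∈E with ∈-grid⁻ evenPt h k p∈E
  ...     | i , j , i< , j< , eq = even∈ i j (ℕP.≤-trans i< h≤) (ℕP.≤-trans j< k≤) eq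
  sub p∈ | inj₁ p∈D | inj₂ p∈O with ∈-grid⁻ innerPt h′ k′ p∈O
  ...     | i , j , i< , j< , eq = odd∈ (suc i) (suc j) (s≤s (ℕP.≤-trans i< h′≤)) (s≤s (ℕP.≤-trans j< k′≤)) eq
  sub p∈ | inj₂ (a , a∈ , p∈a) with ∈-++⁻ (grid evenPt h k) a∈
  ...   | inj₁ a∈E with ∈-grid⁻ evenPt h k a∈E
  ...     | i , j , i< , j< , refl = nbrE i j i< j< p∈a
  sub {p} p∈ | inj₂ (a , a∈ , p∈a) | inj₂ a∈O with ∈-grid⁻ innerPt h′ k′ a∈O
  ...     | i , j , i< , j< , refl = nbrO i j i< j< (subst (λ a → p ∈ neighbours a) (innerPt≡ i j) p∈a)

-- The reflection that exchanges rows and columns.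

reflect : Pt → Pt
reflect (x , y) = - x , y

reflect-involutive : ∀ p → reflect (reflect p) ≡ p
reflect-involutive (x , y) = cong (_, y) (ℤP.neg-involutive x)

reflect-injective : ∀ {p q} → reflect p ≡ reflect q → p ≡ q
reflect-injective {p} {q} eq =
  trans (sym (reflect-involutive p)) (trans (cong reflect eq) (reflect-involutive q))

reflect-neighbours : ∀ {p q} → q ∈ neighbours p → reflect q ∈ neighbours (reflect p)
reflect-neighbours {x , y} (here refl) = there (here (cong (_, y) (ℤP.neg-distrib-+ x (+ 1))))
reflect-neighbours {x , y} (there (here refl)) = here (cong (_, y) (ℤP.neg-distrib-+ x (- + 1)))
reflect-neighbours (there (there (here refl))) = there (there (here refl))
reflect-neighbours (there (there (there (here refl)))) = there (there (there (here refl)))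

-- One inequality suffices: minimality of the mirror image applies it once to `A` and once to the
-- competing set.
boundary-reflect≤ : ∀ {A} → Unique A → length (boundary (map reflect A)) ≤ length (boundary A)
boundary-reflect≤ {A} u = ℕP.+-cancelˡ-≤ (length A) _ _ (begin
  length A + length (boundary A′)   ≡⟨ cong (_+ length (boundary A′)) (LP.length-map reflect A) ⟨
  length A′ + length (boundary A′)  ≡⟨ length-closure A′ ⟨
  length (closure A′)               ≤⟨ unique-⊆⇒length≤ (closure-unique (UP.map⁺ reflect-injective u)) sub ⟩
  length (map reflect (closure A))  ≡⟨ LP.length-map reflect (closure A) ⟩
  length (closure A)                ≡⟨ length-closure A ⟩
  length A + length (boundary A)    ∎)
  where
  open ℕP.≤-Reasoning
  A′ = map reflect A
  sub : closure A′ ⊆ map reflect (closure A)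
  sub {p} p∈ with ∈-closure⁻ A′ p∈
  ... | inj₁ p∈A′ with ∈-map⁻ reflect p∈A′
  ...   | a , a∈ , refl = ∈-map⁺ reflect (∈-++⁺ˡ a∈)
  sub {p} p∈ | inj₂ (a′ , a′∈ , p∈a′) with ∈-map⁻ reflect a′∈
  ...   | a , a∈ , refl = subst (_∈ _) (reflect-involutive p) (∈-map⁺ reflect
            (neighbours⊆closure a∈ (subst (λ b → reflect p ∈ neighbours b) (reflect-involutive a) (reflect-neighbours p∈a′))))

minimal-reflect : ∀ {A} → Minimal A → Minimal (map reflect A)
minimal-reflect {A} (nonempty , u , min) = nonempty ∘ empty A , UP.map⁺ reflect-injective u , λ C uC eq → begin
  length (boundary (map reflect A)) ≤⟨ boundary-reflect≤ u ⟩
  length (boundary A)               ≤⟨ min (map reflect C) (UP.map⁺ reflect-injective uC)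
                                         (trans (LP.length-map reflect C) (trans eq (LP.length-map reflect A))) ⟩
  length (boundary (map reflect C)) ≤⟨ boundary-reflect≤ uC ⟩
  length (boundary C)               ∎
  where
  open ℕP.≤-Reasoning
  empty : ∀ A → map reflect A ≡ [] → A ≡ []
  empty [] _ = refl

-- Rows and the steps between them.

row : Pt → ℤ
row (x , y) = y - x

-- The four neighbours of a point, two in the next row and two in the previous one. The variants
-- marked `⁺` are the unmarked ones applied to `diag p`, the next position in the row of `p`.
up up⁺ down down⁺ diag : Pt → Pt
up    (x , y) = x - + 1 , y
up⁺   (x , y) = x , y ℤ.+ + 1
down  (x , y) = x , y - + 1
down⁺ (x , y) = x ℤ.+ + 1 , y
diag  (x , y) = x ℤ.+ + 1 , y ℤ.+ + 1

[i+1]-1 : ∀ i → i ℤ.+ + 1 - + 1 ≡ i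
[i+1]-1 = solve-∀

[i-1]+1 : ∀ i → i - + 1 ℤ.+ + 1 ≡ i
[i-1]+1 = solve-∀

row-up : ∀ p → row (up p) ≡ row p ℤ.+ + 1
row-up (x , y) = eq x y
  where
  eq : ∀ x y → y - (x - + 1) ≡ y - x ℤ.+ + 1
  eq = solve-∀

row-diag : ∀ p → row (diag p) ≡ row p
row-diag (x , y) = eq x y
  where
  eq : ∀ x y → y ℤ.+ + 1 - (x ℤ.+ + 1) ≡ y - x
  eq = solve-∀

row-down : ∀ p → row (down p) ≡ row p - + 1
row-down (x , y) = eq x y
  where
  eq : ∀ x y → y - + 1 - x ≡ y - x - + 1
  eq = solve-∀

up-diag : ∀ p → up (diag p) ≡ up⁺ p
up-diag (x , y) = cong (_, y ℤ.+ + 1) ([i+1]-1 x)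

down-diag : ∀ p → down (diag p) ≡ down⁺ p
down-diag (x , y) = cong (x ℤ.+ + 1 ,_) ([i+1]-1 y)

down⁺-up : ∀ p → down⁺ (up p) ≡ p
down⁺-up (x , y) = cong (_, y) ([i-1]+1 x)

down-up⁺ : ∀ p → down (up⁺ p) ≡ p
down-up⁺ (x , y) = cong (x ,_) ([i+1]-1 y)

up⁺-down : ∀ p → up⁺ (down p) ≡ p
up⁺-down (x , y) = cong (x ,_) ([i-1]+1 y)

up-down⁺ : ∀ p → up (down⁺ p) ≡ p
up-down⁺ (x , y) = cong (_, y) ([i+1]-1 x)

row-up⁺ : ∀ p → row (up⁺ p) ≡ row p ℤ.+ + 1
row-up⁺ p = trans (cong row (sym (up-diag p))) (trans (row-up (diag p)) (cong (ℤ._+ + 1) (row-diag p)))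

row-down⁺ : ∀ p → row (down⁺ p) ≡ row p - + 1
row-down⁺ p = trans (cong row (sym (down-diag p))) (trans (row-down (diag p)) (cong (_- + 1) (row-diag p)))

leftInverse⇒injective : {X Y : Set} {f : X → Y} {g : Y → X} → (∀ x → g (f x) ≡ x) → ∀ {x y} → f x ≡ f y → x ≡ y
leftInverse⇒injective {g = g} inv {x} {y} eq = trans (sym (inv x)) (trans (cong g eq) (inv y))

up-injective : ∀ {p q} → up p ≡ up q → p ≡ q
up-injective = leftInverse⇒injective {g = down⁺} down⁺-up

up⁺-injective : ∀ {p q} → up⁺ p ≡ up⁺ q → p ≡ q
up⁺-injective = leftInverse⇒injective {g = down} down-up⁺

down-injective : ∀ {p q} → down p ≡ down q → p ≡ q
down-injective = leftInverse⇒injective {g = up⁺} up⁺-down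

diag-injective : ∀ {p q} → diag p ≡ diag q → p ≡ q
diag-injective {p} {q} eq = up⁺-injective (trans (sym (up-diag p)) (trans (cong up eq) (up-diag q)))

≢i+1 : ∀ {i j} → i ℤ.≤ j → i ≢ j ℤ.+ + 1
≢i+1 i≤j refl = ℤP.<⇒≱ (i<i+1 _) i≤j

≢i-1 : ∀ {i j} → j ℤ.≤ i → i ≢ j - + 1
≢i-1 j≤i refl = ℤP.<⇒≱ (i-1<i _) j≤i

i+1≤j : ∀ {i j} → i ℤ.< j → i ℤ.+ + 1 ℤ.≤ j
i+1≤j {i} i<j = subst (ℤ._≤ _) (ℤP.+-comm (+ 1) i) (ℤP.i<j⇒suc[i]≤j i<j)

i≤j-1 : ∀ {i j} → i ℤ.< j → i ℤ.≤ j - + 1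
i≤j-1 {i} {j} i<j = subst (i ℤ.≤_) (ℤP.+-comm (- + 1) j) (ℤP.i<j⇒i≤pred[j] i<j)

-- Shifting the rows apart at a threshold: the lower bound for the boundary.

ends : List Pt → List Pt
ends A = filter (λ p → ¬? (diag p ∈? A)) A

rowOf : List Pt → ℤ → List Pt
rowOf A r = filter (λ p → row p ℤP.≟ r) A

∈-rowOf⁻ : ∀ A {r p} → p ∈ rowOf A r → p ∈ A × row p ≡ r
∈-rowOf⁻ A {r} = ∈-filter⁻ (λ p → row p ℤP.≟ r)

∈-rowOf⁺ : ∀ {A r p} → p ∈ A → row p ≡ r → p ∈ rowOf A r
∈-rowOf⁺ {r = r} = ∈-filter⁺ (λ p → row p ℤP.≟ r)

∈⇒0<length : {X : Set} {x : X} {xs : List X} → x ∈ xs → 0 < length xs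
∈⇒0<length (here _) = s≤s z≤n
∈⇒0<length (there _) = s≤s z≤n

0<length⇒∈ : {X : Set} {xs : List X} → 0 < length xs → ∃[ x ] x ∈ xs
0<length⇒∈ {xs = x ∷ xs} _ = x , here refl

module Threshold {A : List Pt} (uA : Unique A) (t : ℤ) where

  shiftBy : ∀ {p} → Dec (row p ℤ.≤ t) → Pt
  shiftBy {p} (yes _) = down p
  shiftBy {p} (no _) = up p

  shift : Pt → Pt
  shift p = shiftBy {p} (row p ℤP.≤? t)

  down≢up : ∀ p q → row p ℤ.≤ t → ¬ row q ℤ.≤ t → down p ≢ up q
  down≢up p q p≤t q≰t eq = q≰t (begin
    row q             <⟨ i<i+1 (row q) ⟩
    row q ℤ.+ + 1     ≡⟨ row-up q ⟨
    row (up q)        ≡⟨ cong row eq ⟨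
    row (down p)      ≡⟨ row-down p ⟩
    row p - + 1       <⟨ i-1<i (row p) ⟩
    row p             ≤⟨ p≤t ⟩
    t                 ∎)
    where open ℤP.≤-Reasoning

  shift-injective : ∀ {p q} → shift p ≡ shift q → p ≡ q
  shift-injective {p} {q} eq with row p ℤP.≤? t | row q ℤP.≤? t
  ... | yes _   | yes _   = down-injective eq
  ... | no _    | no _    = up-injective eq
  ... | yes p≤t | no q≰t  = contradiction eq (down≢up p q p≤t q≰t)
  ... | no p≰t  | yes q≤t = contradiction (sym eq) (down≢up q p q≤t p≰t)

  -- The shift carries `q` or `diag q` to `p`. The constructors record on which side of `p` the
  -- point `q` lies.
  data Hit (p : Pt) : Pt → Set where
    from-above  : ∀ {q} → row q ℤ.≤ t → p ≡ down q → Hit p q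
    from-above⁺ : ∀ {q} → row q ℤ.≤ t → p ≡ down⁺ q → Hit p q
    from-below  : ∀ {q} → t ℤ.< row q → p ≡ up q → Hit p q
    from-below⁺ : ∀ {q} → t ℤ.< row q → p ≡ up⁺ q → Hit p q

  hit⇒row : ∀ {p q} → Hit p q → (row q ℤ.≤ t × row p ≡ row q - + 1) ⊎ (t ℤ.< row q × row p ≡ row q ℤ.+ + 1)
  hit⇒row (from-above  {q} q≤t refl) = inj₁ (q≤t , row-down q)
  hit⇒row (from-above⁺ {q} q≤t refl) = inj₁ (q≤t , row-down⁺ q)
  hit⇒row (from-below  {q} t<q refl) = inj₂ (t<q , row-up q)
  hit⇒row (from-below⁺ {q} t<q refl) = inj₂ (t<q , row-up⁺ q)

  hit⇒neighbour : ∀ {p q} → Hit p q → p ∈ neighbours q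
  hit⇒neighbour (from-above  _ refl) = there (there (there (here refl)))
  hit⇒neighbour (from-above⁺ _ refl) = here refl
  hit⇒neighbour (from-below  _ refl) = there (here refl)
  hit⇒neighbour (from-below⁺ _ refl) = there (there (here refl))

  -- A maximal interval of n points in a row has n + 1 neighbours in each adjacent row: the shifts
  -- of its points and of one extra point after its right end. The members of `ends A` are these
  -- right ends.
  thick : List Pt
  thick = A ++ map diag (ends A)

  thick-unique : Unique thick
  thick-unique = UP.++⁺ uA (UP.map⁺ diag-injective (UP.filter⁺ _ uA)) disj
    where
    disj : ∀ {p} → ¬ (p ∈ A × p ∈ map diag (ends A))
    disj (p∈A , p∈) with ∈-map⁻ diag p∈
    ... | q , q∈ , refl = proj₂ (∈-filter⁻ (λ p → ¬? (diag p ∈? A)) {xs = A} q∈) p∈A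

  shift-thick⁻ : ∀ {p} → p ∈ map shift thick → ∃[ q ] (q ∈ A × Hit p q)
  shift-thick⁻ p∈ with ∈-map⁻ shift p∈
  ... | q , q∈ , eq with ∈-++⁻ A q∈
  ...   | inj₁ q∈A with row q ℤP.≤? t
  ...     | yes q≤t = q , q∈A , from-above q≤t eq
  ...     | no q≰t = q , q∈A , from-below (ℤP.≰⇒> q≰t) eq
  shift-thick⁻ p∈ | q , q∈ , eq | inj₂ q∈⁺ with ∈-map⁻ diag q∈⁺
  ...   | r , r∈ , refl with row (diag r) ℤP.≤? t | proj₁ (∈-filter⁻ (λ p → ¬? (diag p ∈? A)) {xs = A} r∈)
  ...     | yes q≤t | r∈A = r , r∈A , from-above⁺ (subst (ℤ._≤ t) (row-diag r) q≤t) (trans eq (down-diag r))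
  ...     | no q≰t  | r∈A = r , r∈A , from-below⁺ (subst (t ℤ.<_) (row-diag r) (ℤP.≰⇒> q≰t)) (trans eq (up-diag r))

  -- Row r receives nothing under the shift. It is enough to test points of `A`, since the extra
  -- points of `thick` lie in the same rows.
  Free : ℤ → Set
  Free r = ∀ {q} → q ∈ A → (row q ℤ.≤ t → r ≢ row q - + 1) × (t ℤ.< row q → r ≢ row q ℤ.+ + 1)

  free⇒¬hit : ∀ {p q} → Free (row p) → q ∈ A → ¬ Hit p q
  free⇒¬hit free q∈ hit with hit⇒row hit
  ... | inj₁ (q≤t , eq) = proj₁ (free q∈) q≤t eq
  ... | inj₂ (t<q , eq) = proj₂ (free q∈) t<q eq

  module _ {Z : List Pt} (uZ : Unique Z) (Z⊆ : Z ⊆ closure A) (free : ∀ {z} → z ∈ Z → Free (row z)) where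

    W : List Pt
    W = map shift thick ++ Z

    length-W : length W ≡ length A + (length (ends A) + length Z)
    length-W = begin
      length W                                              ≡⟨ LP.length-++ (map shift thick) ⟩
      length (map shift thick) + length Z                   ≡⟨ cong (_+ length Z) (LP.length-map shift thick) ⟩
      length thick + length Z                               ≡⟨ cong (_+ length Z) (LP.length-++ A) ⟩
      length A + length (map diag (ends A)) + length Z      ≡⟨ cong (λ l → length A + l + length Z) (LP.length-map diag (ends A)) ⟩
      length A + length (ends A) + length Z                 ≡⟨ ℕP.+-assoc (length A) _ _ ⟩
      length A + (length (ends A) + length Z)               ∎
      where open ≡-Reasoning

    W-unique : Unique W
    W-unique = UP.++⁺ (UP.map⁺ shift-injective thick-unique) uZ disj
      where
      disj : ∀ {p} → ¬ (p ∈ map shift thick × p ∈ Z)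
      disj (p∈ , p∈Z) = let q , q∈ , hit = shift-thick⁻ p∈ in free⇒¬hit (free p∈Z) q∈ hit

    W⊆closure : W ⊆ closure A
    W⊆closure p∈ with ∈-++⁻ (map shift thick) p∈
    ... | inj₁ p∈s = let q , q∈ , hit = shift-thick⁻ p∈s in neighbours⊆closure q∈ (hit⇒neighbour hit)
    ... | inj₂ p∈Z = Z⊆ p∈Z

    boundary≥ : length (ends A) + length Z ≤ length (boundary A)
    boundary≥ = ℕP.+-cancelˡ-≤ (length A) _ _ (begin
      length A + (length (ends A) + length Z) ≡⟨ length-W ⟨
      length W                                ≤⟨ unique-⊆⇒length≤ W-unique W⊆closure ⟩
      length (closure A)                      ≡⟨ length-closure A ⟩
      length A + length (boundary A)          ∎)
      where open ℕP.≤-Reasoning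

    -- If the lower bound is attained, the inclusion of `W` in `closure A` is an equality, so each
    -- point of A ∪ ∂A is in `Z` or comes from the shift.
    tight⇒covered : length (boundary A) ≤ length (ends A) + length Z →
                    ∀ {p} → p ∈ closure A → p ∈ Z ⊎ ∃[ q ] (q ∈ A × Hit p q)
    tight⇒covered le p∈ with ∈-++⁻ (map shift thick) (unique-⊆-length≥⇒⊇ W-unique W⊆closure (begin
        length (closure A)                      ≡⟨ length-closure A ⟩
        length A + length (boundary A)          ≤⟨ ℕP.+-monoʳ-≤ (length A) le ⟩
        length A + (length (ends A) + length Z) ≡⟨ length-W ⟨
        length W                                ∎) p∈)
      where open ℕP.≤-Reasoning
    ... | inj₁ p∈s = inj₂ (shift-thick⁻ p∈s)
    ... | inj₂ p∈Z = inj₁ p∈Z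

  -- Rows up to `t` land in row t - 1 or lower and rows above `t` in row t + 2 or higher, which
  -- leaves rows t and t + 1 empty.
  free-t : Free t
  free-t q∈ = ≢i-1 , λ t<q → ≢i+1 (ℤP.<⇒≤ t<q)

  free-t+1 : Free (t ℤ.+ + 1)
  free-t+1 {q} q∈ = (λ q≤t → ≢i-1 (ℤP.≤-trans q≤t (ℤP.<⇒≤ (i<i+1 t)))) , λ t<q → ≢i+1 (i+1≤j t<q)

-- The structure of the rows when the bound is attained.

-- In `along`, the bound on the abscissa makes repeated `diag` steps from any point of the peak row
-- end at `peak`.
record RowStructure (A : List Pt) : Set where
  field
    peak    : Pt
    peak∈   : peak ∈ A
    ascend  : ∀ {p} → p ∈ A → row p ℤ.< row peak → up p ∈ A ⊎ up⁺ p ∈ A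
    descend : ∀ {p} → p ∈ A → row peak ℤ.< row p → down p ∈ A ⊎ down⁺ p ∈ A
    along   : ∀ {p} → p ∈ A → row p ≡ row peak → proj₁ p ℤ.≤ proj₁ peak × (p ≡ peak ⊎ diag p ∈ A)

-- For a row with right end c these are one point more than its size, and all of its neighbours
-- above respectively below just when the row is an interval.
cap floor : List Pt → Pt → List Pt
cap A c = up⁺ c ∷ map up (rowOf A (row c))
floor A c = down⁺ c ∷ map down (rowOf A (row c))

RightEnd : List Pt → Pt → Set
RightEnd A c = c ∈ A × (∀ {p} → p ∈ A → row p ≡ row c → proj₁ p ℤ.≤ proj₁ c)

rightEnd : ∀ {A p} → p ∈ A → ∃[ c ] (RightEnd A c × row c ≡ row p)
rightEnd {A} p∈ with maximiser proj₁ (∈-rowOf⁺ p∈ refl)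
... | c , c∈ , max with ∈-rowOf⁻ A c∈
...   | c∈A , eq = c , (c∈A , λ q∈ eq′ → max (∈-rowOf⁺ q∈ (trans eq′ eq))) , eq

diag-rightEnd∉ : ∀ {A c} → RightEnd A c → diag c ∉ A
diag-rightEnd∉ {c = c} (_ , max) d∈ = ℤP.<⇒≱ (i<i+1 _) (max d∈ (row-diag c))

module _ {A c} (uA : Unique A) (end : RightEnd A c) where

  -- The added point `up⁺ c` is `up (diag c)`, and `diag c` is outside `A` because `c` is a right
  -- end.
  cap-unique : Unique (cap A c)
  cap-unique = AllP.¬Any⇒All¬ _ new ∷ UP.map⁺ up-injective (UP.filter⁺ _ uA)
    where
    new : up⁺ c ∉ map up (rowOf A (row c))
    new c∈ with ∈-map⁻ up c∈
    ... | q , q∈ , eq with up-injective {diag c} {q} (trans (up-diag c) eq)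
    ...   | refl = diag-rightEnd∉ end (proj₁ (∈-rowOf⁻ A q∈))

  floor-unique : Unique (floor A c)
  floor-unique = AllP.¬Any⇒All¬ _ new ∷ UP.map⁺ down-injective (UP.filter⁺ _ uA)
    where
    new : down⁺ c ∉ map down (rowOf A (row c))
    new c∈ with ∈-map⁻ down c∈
    ... | q , q∈ , eq with down-injective {diag c} {q} (trans (down-diag c) eq)
    ...   | refl = diag-rightEnd∉ end (proj₁ (∈-rowOf⁻ A q∈))

  cap⊆closure : cap A c ⊆ closure A
  cap⊆closure (here refl) = neighbours⊆closure (proj₁ end) (there (there (here refl)))
  cap⊆closure (there p∈) with ∈-map⁻ up p∈
  ... | q , q∈ , refl = neighbours⊆closure (proj₁ (∈-rowOf⁻ A q∈)) (there (here refl))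

  floor⊆closure : floor A c ⊆ closure A
  floor⊆closure (here refl) = neighbours⊆closure (proj₁ end) (here refl)
  floor⊆closure (there p∈) with ∈-map⁻ down p∈
  ... | q , q∈ , refl = neighbours⊆closure (proj₁ (∈-rowOf⁻ A q∈)) (there (there (there (here refl))))

  row-cap : ∀ {p} → p ∈ cap A c → row p ≡ row c ℤ.+ + 1
  row-cap (here refl) = row-up⁺ c
  row-cap (there p∈) with ∈-map⁻ up p∈
  ... | q , q∈ , refl = trans (row-up q) (cong (ℤ._+ + 1) (proj₂ (∈-rowOf⁻ A q∈)))

  row-floor : ∀ {p} → p ∈ floor A c → row p ≡ row c - + 1
  row-floor (here refl) = row-down⁺ c
  row-floor (there p∈) with ∈-map⁻ down p∈
  ... | q , q∈ , refl = trans (row-down q) (cong (_- + 1) (proj₂ (∈-rowOf⁻ A q∈)))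

length-cap : ∀ A c → length (cap A c) ≡ suc (length (rowOf A (row c)))
length-cap A c = cong suc (LP.length-map up (rowOf A (row c)))

length-floor : ∀ A c → length (floor A c) ≡ suc (length (rowOf A (row c)))
length-floor A c = cong suc (LP.length-map down (rowOf A (row c)))

module _ {A c} (uA : Unique A) (end : RightEnd A c) {X : List Pt}
         (uX : Unique X) (X⊆ : X ⊆ closure A) (row-X : ∀ {p} → p ∈ X → row p ≡ row c) where

  open Threshold uA (row c)

  private
    Z = X ++ cap A c

    uZ : Unique Z
    uZ = UP.++⁺ uX (cap-unique uA end) λ (p∈X , p∈cap) →
      ≢i+1 ℤP.≤-refl (trans (sym (row-X p∈X)) (row-cap uA end p∈cap))

    Z⊆ : Z ⊆ closure A
    Z⊆ p∈ with ∈-++⁻ X p∈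
    ... | inj₁ p∈X = X⊆ p∈X
    ... | inj₂ p∈cap = cap⊆closure uA end p∈cap

    free : ∀ {z} → z ∈ Z → Free (row z)
    free z∈ with ∈-++⁻ X z∈
    ... | inj₁ z∈X = subst Free (sym (row-X z∈X)) free-t
    ... | inj₂ z∈cap = subst Free (sym (row-cap uA end z∈cap)) free-t+1

  -- With t = `row c`, the sets `X` and `cap A c` occupy the free rows t and t + 1. A point of `A`
  -- below row t can be covered only by a downward shift from the next row, and one above row t + 1
  -- only by an upward shift from the previous row. A point in row t + 1 belongs to the cap, hence
  -- has a neighbour in row t.
  tight⇒rowStructure : length (boundary A) ≤ length (ends A) + length (X ++ cap A c) → RowStructure A
  tight⇒rowStructure tight = record { peak = c ; peak∈ = proj₁ end ; ascend = ascend ; descend = descend ; along = along }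
    where
    covered : ∀ {p} → p ∈ closure A → p ∈ Z ⊎ ∃[ q ] (q ∈ A × Hit p q)
    covered = tight⇒covered uZ Z⊆ free tight
    t≤row : ∀ {p} → p ∈ Z → row c ℤ.≤ row p
    t≤row p∈ with ∈-++⁻ X p∈
    ... | inj₁ p∈X = ℤP.≤-reflexive (sym (row-X p∈X))
    ... | inj₂ p∈cap = ℤP.≤-trans (ℤP.<⇒≤ (i<i+1 _)) (ℤP.≤-reflexive (sym (row-cap uA end p∈cap)))
    ascend : ∀ {p} → p ∈ A → row p ℤ.< row c → up p ∈ A ⊎ up⁺ p ∈ A
    ascend {p} p∈ p<c with covered (∈-++⁺ˡ p∈)
    ... | inj₁ p∈Z = contradiction (t≤row p∈Z) (ℤP.<⇒≱ p<c)
    ... | inj₂ (q , q∈ , from-above _ refl) = inj₂ (subst (_∈ A) (sym (up⁺-down q)) q∈)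
    ... | inj₂ (q , q∈ , from-above⁺ _ refl) = inj₁ (subst (_∈ A) (sym (up-down⁺ q)) q∈)
    ... | inj₂ (q , q∈ , from-below c<q refl) = contradiction (subst (ℤ._< row c) (row-up q) p<c)
                                                  (ℤP.<-asym (ℤP.<-trans c<q (i<i+1 _)))
    ... | inj₂ (q , q∈ , from-below⁺ c<q refl) = contradiction (subst (ℤ._< row c) (row-up⁺ q) p<c)
                                                  (ℤP.<-asym (ℤP.<-trans c<q (i<i+1 _)))
    descend : ∀ {p} → p ∈ A → row c ℤ.< row p → down p ∈ A ⊎ down⁺ p ∈ A
    descend {p} p∈ c<p with covered (∈-++⁺ˡ p∈)
    ... | inj₂ (q , q∈ , from-above q≤c refl) = contradiction (subst (row c ℤ.<_) (row-down q) c<p)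
                                                  (ℤP.<-asym (ℤP.<-≤-trans (i-1<i _) q≤c))
    ... | inj₂ (q , q∈ , from-above⁺ q≤c refl) = contradiction (subst (row c ℤ.<_) (row-down⁺ q) c<p)
                                                  (ℤP.<-asym (ℤP.<-≤-trans (i-1<i _) q≤c))
    ... | inj₂ (q , q∈ , from-below _ refl) = inj₂ (subst (_∈ A) (sym (down⁺-up q)) q∈)
    ... | inj₂ (q , q∈ , from-below⁺ _ refl) = inj₁ (subst (_∈ A) (sym (down-up⁺ q)) q∈)
    ... | inj₁ p∈Z with ∈-++⁻ X p∈Z
    ...   | inj₁ p∈X = contradiction c<p (ℤP.<-irrefl (sym (row-X p∈X)))
    ...   | inj₂ (here refl) = inj₁ (subst (_∈ A) (sym (down-up⁺ c)) (proj₁ end))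
    ...   | inj₂ (there p∈m) with ∈-map⁻ up p∈m
    ...     | q , q∈ , refl = inj₂ (subst (_∈ A) (sym (down⁺-up q)) (proj₁ (∈-rowOf⁻ A q∈)))
    along : ∀ {p} → p ∈ A → row p ≡ row c → proj₁ p ℤ.≤ proj₁ c × (p ≡ c ⊎ diag p ∈ A)
    along {p} p∈ eq = proj₂ end p∈ eq , next
      where
      row-eq : row (up⁺ p) ≡ row c ℤ.+ + 1
      row-eq = trans (row-up⁺ p) (cong (ℤ._+ + 1) eq)
      next : p ≡ c ⊎ diag p ∈ A
      -- `up⁺ p` is in the free row t + 1, hence in the cap: as `up⁺ c` it gives `p ≡ c`, and as
      -- `up q` it gives `q ≡ diag p`.
      next with covered (neighbours⊆closure p∈ (there (there (here refl))))
      ... | inj₂ (q , q∈ , hit) = contradiction hit (free⇒¬hit (subst Free (sym row-eq) free-t+1) q∈)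
      ... | inj₁ p∈Z with ∈-++⁻ X p∈Z
      ...   | inj₁ p∈X = contradiction (trans (sym (row-X p∈X)) row-eq) (≢i+1 ℤP.≤-refl)
      ...   | inj₂ (here e) = inj₁ (up⁺-injective {p} {c} e)
      ...   | inj₂ (there p∈m) with ∈-map⁻ up p∈m
      ...     | q , q∈ , e with up-injective {diag p} {q} (trans (up-diag p) e)
      ...       | refl = inj₂ (proj₁ (∈-rowOf⁻ A q∈))

-- Counting the points row by row.

rowSize : List Pt → ℤ → ℕ
rowSize A r = length (rowOf A r)

length-filter-⊎ : ∀ {X : Set} {P Q R : Pred X 0ℓ} (P? : Decidable P) (Q? : Decidable Q) (R? : Decidable R) →
  (∀ {x} → R x → P x ⊎ Q x) → (∀ {x} → P x → R x) → (∀ {x} → Q x → R x) → (∀ {x} → P x → ¬ Q x) →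
  ∀ xs → length (filter R? xs) ≡ length (filter P? xs) + length (filter Q? xs)
length-filter-⊎ P? Q? R? split P⇒R Q⇒R excl [] = refl
length-filter-⊎ P? Q? R? split P⇒R Q⇒R excl (x ∷ xs)
  with ih ← length-filter-⊎ P? Q? R? split P⇒R Q⇒R excl xs | P? x | Q? x | R? x
... | yes p | yes q | _     = contradiction q (excl p)
... | yes p | no _  | yes _ = cong suc ih
... | yes p | no _  | no ¬r = contradiction (P⇒R p) ¬r
... | no _  | yes q | yes _ = trans (cong suc ih) (sym (ℕP.+-suc _ _))
... | no _  | yes q | no ¬r = contradiction (Q⇒R q) ¬r
... | no ¬p | no ¬q | yes r = contradiction (split r) [ ¬p , ¬q ]′
... | no _  | no _  | no _  = ih

i<j+1⇒i<j⊎i≡j : ∀ {i j} → i ℤ.< j ℤ.+ + 1 → i ℤ.< j ⊎ i ≡ j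
i<j+1⇒i<j⊎i≡j {i} {j} lt with i ℤP.≟ j
... | yes eq = inj₂ eq
... | no i≢j = inj₁ (ℤP.≤∧≢⇒< (subst (i ℤ.≤_) ([i+1]-1 j) (i≤j-1 lt)) i≢j)

row-has-end : ∀ A r → 0 < rowSize A r → 0 < rowSize (ends A) r
row-has-end A r lt with 0<length⇒∈ lt
... | p , p∈ with ∈-rowOf⁻ A p∈
...   | p∈A , refl with rightEnd p∈A
...     | c , end , eq = ∈⇒0<length (∈-rowOf⁺ (∈-filter⁺ _ (proj₁ end) (diag-rightEnd∉ end)) eq)

-- Adjacent rows, with `s` equal to r + 1, are allowed here; `Separated` treats the remaining gaps.
record Gap (A : List Pt) (m : ℕ) : Set where
  constructor mkGap
  field
    {r s}  : ℤ
    r<s    : r ℤ.< s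
    size-r : rowSize A r ≡ m
    size-s : rowSize A s ≡ m
    empty  : ∀ {p} → p ∈ A → r ℤ.< row p → ¬ row p ℤ.< s

module Count {A : List Pt} {k : ℕ} (bound : ∀ r → rowSize A r ≤ suc k)
             {lo : ℤ} (lo≤ : ∀ {p} → p ∈ A → lo ℤ.≤ row p) where

  level : ℕ → ℤ
  level i = lo ℤ.+ + i

  level-suc : ∀ i → level (suc i) ≡ level i ℤ.+ + 1
  level-suc i = eq lo (+ i)
    where
    eq : ∀ l i → l ℤ.+ (+ 1 ℤ.+ i) ≡ l ℤ.+ i ℤ.+ + 1
    eq = solve-∀

  below : ℕ → List Pt → List Pt
  below i L = filter (λ p → row p ℤP.<? level i) L

  #A #E : ℕ → ℕ
  #A i = length (below i A)
  #E i = length (below i (ends A))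

  length-below-suc : ∀ i L → length (below (suc i) L) ≡ length (below i L) + rowSize L (level i)
  length-below-suc i = length-filter-⊎ _ _ _
    (λ lt → i<j+1⇒i<j⊎i≡j (subst (_ ℤ.<_) (level-suc i) lt))
    (λ lt → subst (_ ℤ.<_) (sym (level-suc i)) (ℤP.<-trans lt (i<i+1 _)))
    (λ eq → subst (_ ℤ.<_) (sym (level-suc i)) (subst (ℤ._< level i ℤ.+ + 1) (sym eq) (i<i+1 _)))
    (λ lt eq → ℤP.<-irrefl eq lt)

  below-0 : ∀ {L} → L ⊆ A → length (below 0 L) ≡ 0
  below-0 {L} L⊆A = cong length (LP.filter-none (λ p → row p ℤP.<? level 0)
    (All.tabulate λ p∈ lt → ℤP.<⇒≱ (subst (_ ℤ.<_) (ℤP.+-identityʳ lo) lt) (lo≤ (L⊆A p∈))))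

  -- Each nonempty row has at most `suc k` points and at least one end.
  size≤ : ∀ i → #A i ≤ suc k * #E i
  size≤ zero = subst (_≤ suc k * #E 0) (sym (below-0 id)) z≤n
  size≤ (suc i) = begin
    #A (suc i)                                       ≡⟨ length-below-suc i A ⟩
    #A i + rowSize A (level i)                       ≤⟨ ℕP.+-mono-≤ (size≤ i) this ⟩
    suc k * #E i + suc k * rowSize (ends A) (level i) ≡⟨ ℕP.*-distribˡ-+ (suc k) (#E i) _ ⟨
    suc k * (#E i + rowSize (ends A) (level i))      ≡⟨ cong (suc k *_) (length-below-suc i (ends A)) ⟨
    suc k * #E (suc i)                               ∎
    where
    open ℕP.≤-Reasoning
    this : rowSize A (level i) ≤ suc k * rowSize (ends A) (level i)
    this with rowSize A (level i) in eq
    ... | zero = z≤n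
    ... | suc a = ℕP.≤-trans (subst (_≤ suc k) eq (bound (level i)))
      (ℕP.m≤m*n (suc k) _ {{ℕ.>-nonZero (row-has-end A (level i) (subst (0 <_) (sym eq) (s≤s z≤n)))}})

  c : ℕ
  c = suc (2 * k)

  -- With m = `suc k`, so that `c` is 2m - 1, the scan follows the excess of 2 `#A` over `c` times
  -- `#E` from the lowest row upwards. A row of size m raises it by at most 1, and a smaller
  -- nonempty row lowers it by at least 1. It can exceed 1 only after two rows of size m with
  -- nothing between them, which form a `Gap`; `large` remembers the last row of size m in order to
  -- detect this.
  data Scan (i : ℕ) : Set where
    gap   : Gap A (suc k) → Scan i
    small : 2 * #A i ≤ c * #E i → Scan i
    large : ∀ r → r ℤ.< level i → rowSize A r ≡ suc k →
            (∀ {p} → p ∈ A → r ℤ.< row p → ¬ row p ℤ.< level i) →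
            2 * #A i ≤ suc (c * #E i) → Scan i

  scan : ∀ i → Scan i
  scan zero = small (subst (λ n → 2 * n ≤ c * #E 0) (sym (below-0 id)) z≤n)
  scan (suc i) = extend (scan i)
    where
    open ℕP.≤-Reasoning
    a = rowSize A (level i)
    b = rowSize (ends A) (level i)
    double : 2 * #A (suc i) ≡ 2 * #A i + 2 * a
    double = trans (cong (2 *_) (length-below-suc i A)) (ℕP.*-distribˡ-+ 2 (#A i) a)
    scaled : c * #E (suc i) ≡ c * #E i + c * b
    scaled = trans (cong (c *_) (length-below-suc i (ends A))) (ℕP.*-distribˡ-+ c (#E i) b)
    c≤ : 0 < a → c ≤ c * b
    c≤ a>0 = ℕP.m≤m*n c b {{ℕ.>-nonZero (row-has-end A (level i) a>0)}}
    add-empty : ∀ d → a ≡ 0 → 2 * #A i ≤ d + c * #E i → 2 * #A (suc i) ≤ d + c * #E (suc i)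
    add-empty d a≡0 le = begin
      2 * #A (suc i)               ≡⟨ double ⟩
      2 * #A i + 2 * a             ≡⟨ cong (λ a → 2 * #A i + 2 * a) a≡0 ⟩
      2 * #A i + 0                 ≡⟨ ℕP.+-identityʳ _ ⟩
      2 * #A i                     ≤⟨ le ⟩
      d + c * #E i                 ≤⟨ ℕP.+-monoʳ-≤ d (ℕP.m≤m+n _ (c * b)) ⟩
      d + (c * #E i + c * b)       ≡⟨ cong (λ n → d + n) scaled ⟨
      d + c * #E (suc i)           ∎
    add-small : 0 < a → a ≤ k → 2 * #A i ≤ suc (c * #E i) → 2 * #A (suc i) ≤ c * #E (suc i)
    add-small a>0 a≤k le = begin
      2 * #A (suc i)               ≡⟨ double ⟩
      2 * #A i + 2 * a             ≤⟨ ℕP.+-mono-≤ le (ℕP.*-monoʳ-≤ 2 a≤k) ⟩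
      suc (c * #E i) + 2 * k       ≡⟨ ℕP.+-suc (c * #E i) (2 * k) ⟨
      c * #E i + c                 ≤⟨ ℕP.+-monoʳ-≤ (c * #E i) (c≤ a>0) ⟩
      c * #E i + c * b             ≡⟨ scaled ⟨
      c * #E (suc i)               ∎
    add-large : a ≡ suc k → 2 * #A i ≤ c * #E i → 2 * #A (suc i) ≤ suc (c * #E (suc i))
    add-large a≡ le = begin
      2 * #A (suc i)               ≡⟨ double ⟩
      2 * #A i + 2 * a             ≤⟨ ℕP.+-mono-≤ le (ℕP.≤-reflexive (trans (cong (2 *_) a≡) (ℕP.*-suc 2 k))) ⟩
      c * #E i + suc c             ≡⟨ ℕP.+-suc (c * #E i) c ⟩
      suc (c * #E i + c)           ≤⟨ s≤s (ℕP.+-monoʳ-≤ (c * #E i) (c≤ (subst (0 <_) (sym a≡) (s≤s z≤n)))) ⟩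
      suc (c * #E i + c * b)       ≡⟨ cong suc scaled ⟨
      suc (c * #E (suc i))         ∎
    level< : level i ℤ.< level (suc i)
    level< = subst (level i ℤ.<_) (sym (level-suc i)) (i<i+1 _)
    split : ∀ {r} → r ℤ.< level (suc i) → r ℤ.< level i ⊎ r ≡ level i
    split lt = i<j+1⇒i<j⊎i≡j (subst (_ ℤ.<_) (level-suc i) lt)
    kind : a ≡ 0 ⊎ (0 < a × a ≤ k) ⊎ a ≡ suc k
    kind with a ℕP.≟ 0 | a ℕP.≤? k
    ... | yes a≡0 | _ = inj₁ a≡0
    ... | no a≢0 | yes a≤k = inj₂ (inj₁ (ℕP.n≢0⇒n>0 a≢0 , a≤k))
    ... | no _ | no a≰k = inj₂ (inj₂ (ℕP.≤-antisym (bound (level i)) (ℕP.≰⇒> a≰k)))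
    extend : Scan i → Scan (suc i)
    extend (gap g) = gap g
    extend (small le) with kind
    ... | inj₁ a≡0 = small (add-empty 0 a≡0 le)
    ... | inj₂ (inj₁ (a>0 , a≤k)) = small (add-small a>0 a≤k (ℕP.m≤n⇒m≤1+n le))
    ... | inj₂ (inj₂ a≡) = large (level i) level< a≡
            (λ p∈ lt lt′ → [ ℤP.<-asym lt , (λ eq → ℤP.<-irrefl (sym eq) lt) ]′ (split lt′))
            (add-large a≡ le)
    extend (large r r< size empty le) with kind
    ... | inj₁ a≡0 = large r (ℤP.<-trans r< level<) size
            (λ p∈ lt lt′ → [ empty p∈ lt , (λ eq → ℕP.<⇒≢ (∈⇒0<length (∈-rowOf⁺ p∈ eq)) (sym a≡0)) ]′ (split lt′))
            (add-empty 1 a≡0 le)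
    ... | inj₂ (inj₁ (a>0 , a≤k)) = small (add-small a>0 a≤k le)
    ... | inj₂ (inj₂ a≡) = gap (mkGap r< size a≡ empty)

rowSize-sum : ∀ {A k z} → z ∈ A → (∀ r → rowSize A r ≤ suc k) →
  length A ≤ suc k * length (ends A) × (Gap A (suc k) ⊎ 2 * length A ≤ suc (suc (2 * k) * length (ends A)))
rowSize-sum {A} {k} z∈ bound with maximiser row z∈ | maximiser (λ p → - row p) z∈
... | hi , hi∈ , hi≥ | lo , lo∈ , lo≤ = subst (_≤ _) #A≡ (ℕP.≤-trans (size≤ h) (ℕP.*-monoʳ-≤ (suc k) #E≤)) , conclude (scan h)
  where
  open Count {A} bound {row lo} (λ p∈ → ℤP.neg-cancel-≤ (lo≤ p∈))
  -- One level beyond the highest row, since `below` is strict.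
  h = suc ∣ row lo - row hi ∣
  level-h : level h ≡ row hi ℤ.+ + 1
  level-h = trans (level-suc _) (cong (ℤ._+ + 1) (trans (cong (λ d → row lo ℤ.+ d)
      (ℤP.∣-∣-≤ (ℤP.neg-cancel-≤ (lo≤ hi∈)))) (eq (row lo) (row hi))))
    where
    eq : ∀ l h → l ℤ.+ (h - l) ≡ h
    eq = solve-∀
  #A≡ : #A h ≡ length A
  #A≡ = cong length (LP.filter-all (λ p → row p ℤP.<? level h)
    (All.tabulate λ p∈ → subst (_ ℤ.<_) (sym level-h) (ℤP.≤-<-trans (hi≥ p∈) (i<i+1 _))))
  #E≤ : #E h ≤ length (ends A)
  #E≤ = LP.length-filter (λ p → row p ℤP.<? level h) (ends A)
  widen : 2 * #A h ≤ suc (c * #E h) → 2 * length A ≤ suc (c * length (ends A))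
  widen le = subst (λ n → 2 * n ≤ _) #A≡ (ℕP.≤-trans le (s≤s (ℕP.*-monoʳ-≤ c #E≤)))
  conclude : Scan h → Gap A (suc k) ⊎ 2 * length A ≤ suc (c * length (ends A))
  conclude (gap g) = inj₁ g
  conclude (small le) = inj₂ (widen (ℕP.m≤n⇒m≤1+n le))
  conclude (large _ _ _ _ le) = inj₂ (widen le)

-- Upper bounds for the boundary from diamonds with e rows.

⌈n/2⌉≤1+⌊n/2⌋ : ∀ n → ℕ.⌈ n /2⌉ ≤ suc ℕ.⌊ n /2⌋
⌈n/2⌉≤1+⌊n/2⌋ zero = z≤n
⌈n/2⌉≤1+⌊n/2⌋ (suc zero) = s≤s z≤n
⌈n/2⌉≤1+⌊n/2⌋ (suc (suc n)) = s≤s (⌈n/2⌉≤1+⌊n/2⌋ n)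

2m≤1+2n⇒m≤n : ∀ {m n} → 2 * m ≤ suc (2 * n) → m ≤ n
2m≤1+2n⇒m≤n {m} {n} le with m ℕP.≤? n
... | yes m≤n = m≤n
... | no m≰n = contradiction (begin
  suc (suc (2 * n)) ≡⟨ ℕP.*-suc 2 n ⟨
  2 * suc n         ≤⟨ ℕP.*-monoʳ-≤ 2 (ℕP.≰⇒> m≰n) ⟩
  2 * m             ≤⟨ le ⟩
  suc (2 * n)       ∎) ℕP.1+n≰n
  where open ℕP.≤-Reasoning

module _ {A : List Pt} (min : Minimal A) (e : ℕ) where

  private
    h  = ℕ.⌈ e /2⌉
    h′ = ℕ.⌊ e /2⌋

    h+h′≡e : h + h′ ≡ e
    h+h′≡e = trans (ℕP.+-comm h h′) (ℕP.⌊n/2⌋+⌈n/2⌉≡n e)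

  -- The diamond has m points in each of its e rows; even and odd rows alternate, beginning with an
  -- even one.
  boundary≤even : ∀ m → length A ≤ m * e → length (boundary A) ≤ e + (suc m + suc m)
  boundary≤even m le = begin
    length (boundary A)            ≤⟨ minimal⇒boundary≤diamond min (⌈n/2⌉≤1+⌊n/2⌋ e) (ℕP.n≤1+n m)
                                        (ℕP.⌊n/2⌋≤⌈n/2⌉ e) (ℕP.≤-refl {m}) (ℕP.≤-trans le (ℕP.≤-reflexive size)) ⟩
    suc h + suc h′ + (m + m)       ≡⟨ arith h h′ m ⟩
    h + h′ + (suc m + suc m)       ≡⟨ cong (_+ (suc m + suc m)) h+h′≡e ⟩
    e + (suc m + suc m)            ∎
    where
    open ℕP.≤-Reasoning
    arith : ∀ h h′ m → suc h + suc h′ + (m + m) ≡ h + h′ + (suc m + suc m)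
    arith = ℕSolver.solve-∀
    size : m * e ≡ h * m + h′ * m
    size = trans (ℕP.*-comm m e) (trans (cong (_* m) (sym h+h′≡e)) (ℕP.*-distribʳ-+ m h h′))

  -- The rows of this diamond have alternately `suc k` and k points, beginning with the larger size.
  -- Its capacity is at least half of (2k + 1)e, and the surplus 1 in the hypothesis is lost in
  -- halving.
  boundary≤odd : ∀ k → 2 * length A ≤ suc (suc (2 * k) * e) → length (boundary A) ≤ e + (suc k + suc (suc k))
  boundary≤odd k le = begin
    length (boundary A)            ≤⟨ minimal⇒boundary≤diamond min (⌈n/2⌉≤1+⌊n/2⌋ e) (ℕP.≤-refl {suc k})
                                        (ℕP.⌊n/2⌋≤⌈n/2⌉ e) (ℕP.n≤1+n k) (2m≤1+2n⇒m≤n (ℕP.≤-trans le (s≤s size))) ⟩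
    suc h + suc h′ + (suc k + k)   ≡⟨ arith h h′ k ⟩
    h + h′ + (suc k + suc (suc k)) ≡⟨ cong (_+ (suc k + suc (suc k))) h+h′≡e ⟩
    e + (suc k + suc (suc k))      ∎
    where
    open ℕP.≤-Reasoning
    arith : ∀ h h′ k → suc h + suc h′ + (suc k + k) ≡ h + h′ + (suc k + suc (suc k))
    arith = ℕSolver.solve-∀
    arith₁ : ∀ h h′ k → suc (2 * k) * (h + h′) ≡ 2 * (h * k + h′ * k) + (h + h′)
    arith₁ = ℕSolver.solve-∀
    arith₂ : ∀ h h′ k → 2 * (h * k + h′ * k) + (h + h) ≡ 2 * (h * suc k + h′ * k)
    arith₂ = ℕSolver.solve-∀
    size : suc (2 * k) * e ≤ 2 * (h * suc k + h′ * k)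
    size = begin
      suc (2 * k) * e                       ≡⟨ cong (suc (2 * k) *_) h+h′≡e ⟨
      suc (2 * k) * (h + h′)                ≡⟨ arith₁ h h′ k ⟩
      2 * (h * k + h′ * k) + (h + h′)       ≤⟨ ℕP.+-monoʳ-≤ (2 * (h * k + h′ * k)) (ℕP.+-monoʳ-≤ h (ℕP.⌊n/2⌋≤⌈n/2⌉ e)) ⟩
      2 * (h * k + h′ * k) + (h + h)        ≡⟨ arith₂ h h′ k ⟩
      2 * (h * suc k + h′ * k)              ∎

-- Automorphisms and congruence.

automorphism : (f g : Pt → Pt) → (∀ p → g (f p) ≡ p) → (∀ p → f (g p) ≡ p) →
  (∀ p q → ∣ proj₁ (f p) - proj₁ (f q) ∣ ≡ ∣ proj₁ p - proj₁ q ∣) →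
  (∀ p q → ∣ proj₂ (f p) - proj₂ (f q) ∣ ≡ ∣ proj₂ p - proj₂ q ∣) → IsAutomorphism f
automorphism f g gf fg isoˣ isoʸ =
  (leftInverse⇒injective {g = g} gf , λ q → g q , λ { refl → fg q }) ,
  λ p q → mk⇔ (trans (cong₂ _+_ (isoˣ p q) (isoʸ p q))) (trans (sym (cong₂ _+_ (isoˣ p q) (isoʸ p q))))

-- Moves (a , b) to the origin and reverses the first axis, so that the antidiagonal successor
-- `up (up⁺ c)` of c = (a , b) lands on (1 , 1).
flip : Pt → Pt → Pt
flip (a , b) (x , y) = a - x , y - b

flip-automorphism : ∀ c → IsAutomorphism (flip c)
flip-automorphism (a , b) = automorphism (flip (a , b)) (λ (x , y) → a - x , y ℤ.+ b)
  (λ (x , y) → cong₂ _,_ (e₁ a x) (e₂ b y)) (λ (x , y) → cong₂ _,_ (e₁ a x) (e₃ b y))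
  (λ (x , _) (x′ , _) → trans (cong ∣_∣ (e₄ a x x′)) (ℤP.∣i-j∣≡∣j-i∣ x′ x))
  (λ (_ , y) (_ , y′) → cong ∣_∣ (e₅ b y y′))
  where
  e₁ : ∀ a x → a - (a - x) ≡ x
  e₁ = solve-∀
  e₂ : ∀ b y → y - b ℤ.+ b ≡ y
  e₂ = solve-∀
  e₃ : ∀ b y → y ℤ.+ b - b ≡ y
  e₃ = solve-∀
  e₄ : ∀ a x x′ → a - x - (a - x′) ≡ x′ - x
  e₄ = solve-∀
  e₅ : ∀ b y y′ → y - b - (y′ - b) ≡ y - y′
  e₅ = solve-∀

antidiagonal⇒congruent : ∀ {A} c → c ∈ A → up (up⁺ c) ∈ A → (∀ {p} → p ∈ A → p ≡ c ⊎ p ≡ up (up⁺ c)) → Congruent A B02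
antidiagonal⇒congruent {A} c@(a , b) c∈ d∈ only = flip c , flip-automorphism c , onto , λ where
    _ (here refl) → c , c∈ , flip-c
    _ (there (here refl)) → up (up⁺ c) , d∈ , flip-d
  where
  e₁ : ∀ a → a - (a - + 1) ≡ + 1
  e₁ = solve-∀
  e₂ : ∀ b → b ℤ.+ + 1 - b ≡ + 1
  e₂ = solve-∀
  flip-c : flip c c ≡ (+ 0 , + 0)
  flip-c = cong₂ _,_ (ℤP.+-inverseʳ a) (ℤP.+-inverseʳ b)
  flip-d : flip c (up (up⁺ c)) ≡ (+ 1 , + 1)
  flip-d = cong₂ _,_ (e₁ a) (e₂ b)
  onto : ∀ p → p ∈ A → flip c p ∈ B02
  onto p p∈ with only p∈
  ... | inj₁ refl = here flip-c
  ... | inj₂ refl = there (here flip-d)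

reflect-automorphism : IsAutomorphism reflect
reflect-automorphism = automorphism reflect reflect reflect-involutive reflect-involutive
  (λ (x , _) (x′ , _) → trans (cong ∣_∣ (sym (ℤP.neg-distrib-+ x (- x′)))) (ℤP.∣-i∣≡∣i∣ (x - x′)))
  λ _ _ → refl

congruent-reflect : ∀ {A B} → Congruent (map reflect A) B → Congruent A B
congruent-reflect {A} {B} (f , ((inj , sur) , adj) , into , onto) =
  f ∘ reflect , ((reflect-injective ∘ inj , sur′) , adj′) , (λ a a∈ → into _ (∈-map⁺ reflect a∈)) , onto′
  where
  sur′ : ∀ q → ∃[ p ] (∀ {z} → z ≡ p → f (reflect z) ≡ q)
  sur′ q with sur q
  ... | p , eq = reflect p , λ { refl → eq (reflect-involutive p) }
  adj′ : ∀ u v → Adj u v ⇔ Adj (f (reflect u)) (f (reflect v))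
  adj′ u v = mk⇔ (to (adj _ _) ∘ to (proj₂ reflect-automorphism u v)) (from (proj₂ reflect-automorphism u v) ∘ from (adj _ _))
    where open Equivalence
  onto′ : ∀ b → b ∈ B → ∃[ a ] (a ∈ A × f (reflect a) ≡ b)
  onto′ b b∈ with onto b b∈
  ... | a′ , a′∈ , eq with ∈-map⁻ reflect a′∈
  ...   | a , a∈ , refl = a , a∈ , eq

-- A gap between two largest rows leads to the exceptional pair.

length≡1⇒≡ : {X : Set} {xs : List X} {x y : X} → length xs ≡ 1 → x ∈ xs → y ∈ xs → x ≡ y
length≡1⇒≡ {xs = _ ∷ []} _ (here refl) (here refl) = refl

-- The free rows t, t + 1 and s contain 3m + 1 points of the closure, against 2m + 2 for the diamond,
-- so m = 1; then equality holds again, and it forces the lower neighbours of row s into the cap of c.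
module Separated {A : List Pt} (min : Minimal A) {k : ℕ} (bound : ∀ r → rowSize A r ≤ suc k)
  (size : length A ≤ suc k * length (ends A))
  (isolated : ∀ {p} → p ∈ A → rowSize A (row p) ≡ suc k → rowSize A (row p ℤ.+ + 1) ≢ suc k)
  {s : ℤ} {c : Pt} (c<s : row c ℤ.< s) (end : RightEnd A c)
  (size-c : rowSize A (row c) ≡ suc k) (size-s : rowSize A s ≡ suc k)
  (empty : ∀ {p} → p ∈ A → row c ℤ.< row p → ¬ row p ℤ.< s) where

  private
    uA = proj₁ (proj₂ min)
    e = length (ends A)
    t = row c

  open Threshold uA t

  c+1<s : t ℤ.+ + 1 ℤ.< s
  c+1<s = ℤP.≤∧≢⇒< (i+1≤j c<s) λ { refl → isolated {c} (proj₁ end) size-c size-s }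

  -- Only row s - 1 could be shifted onto row s, and it has no points or lies at the threshold,
  -- where it moves down.
  free-s : Free s
  free-s {q} q∈ = (λ q≤t → ≢i-1 (ℤP.≤-trans q≤t (ℤP.<⇒≤ c<s))) ,
              λ t<q eq → empty q∈ t<q (subst (row q ℤ.<_) (sym eq) (i<i+1 _))

  Z : List Pt
  Z = rowOf A t ++ cap A c ++ rowOf A s

  ∈-Z⁻ : ∀ {p} → p ∈ Z → p ∈ rowOf A t ⊎ p ∈ cap A c ⊎ p ∈ rowOf A s
  ∈-Z⁻ p∈ with ∈-++⁻ (rowOf A t) p∈
  ... | inj₁ p∈t = inj₁ p∈t
  ... | inj₂ p∈′ = inj₂ (∈-++⁻ (cap A c) p∈′)

  Z-unique : Unique Z
  Z-unique = UP.++⁺ (UP.filter⁺ _ uA) (UP.++⁺ (cap-unique uA end) (UP.filter⁺ _ uA)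
      λ (p∈ , p∈s) → ℤP.<-irrefl (trans (sym (row-cap uA end p∈)) (proj₂ (∈-rowOf⁻ A p∈s))) c+1<s) disj
    where
    disj : ∀ {p} → ¬ (p ∈ rowOf A t × p ∈ cap A c ++ rowOf A s)
    disj (p∈t , p∈) with ∈-++⁻ (cap A c) p∈
    ... | inj₁ p∈cap = ≢i+1 ℤP.≤-refl (trans (sym (proj₂ (∈-rowOf⁻ A p∈t))) (row-cap uA end p∈cap))
    ... | inj₂ p∈s = ℤP.<-irrefl (trans (sym (proj₂ (∈-rowOf⁻ A p∈t))) (proj₂ (∈-rowOf⁻ A p∈s))) c<s

  Z⊆ : Z ⊆ closure A
  Z⊆ p∈ with ∈-Z⁻ p∈
  ... | inj₁ p∈t = ∈-++⁺ˡ (proj₁ (∈-rowOf⁻ A p∈t))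
  ... | inj₂ (inj₁ p∈cap) = cap⊆closure uA end p∈cap
  ... | inj₂ (inj₂ p∈s) = ∈-++⁺ˡ (proj₁ (∈-rowOf⁻ A p∈s))

  Z-free : ∀ {p} → p ∈ Z → Free (row p)
  Z-free p∈ with ∈-Z⁻ p∈
  ... | inj₁ p∈t = subst Free (sym (proj₂ (∈-rowOf⁻ A p∈t))) free-t
  ... | inj₂ (inj₁ p∈cap) = subst Free (sym (row-cap uA end p∈cap)) free-t+1
  ... | inj₂ (inj₂ p∈s) = subst Free (sym (proj₂ (∈-rowOf⁻ A p∈s))) free-s

  length-Z : length Z ≡ suc k + (suc (suc k) + suc k)
  length-Z = trans (LP.length-++ (rowOf A t)) (cong₂ _+_ size-c (trans (LP.length-++ (cap A c))
    (cong₂ _+_ (trans (length-cap A c) (cong suc size-c)) size-s)))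

  k≡0 : k ≡ 0
  k≡0 = ℕP.n≤0⇒n≡0 (ℕP.+-cancelˡ-≤ (e + (suc (suc k) + suc (suc k))) _ _ (begin
    e + (suc (suc k) + suc (suc k)) + k  ≡⟨ arith e k ⟩
    e + (suc k + (suc (suc k) + suc k))  ≡⟨ cong (λ l → e + l) length-Z ⟨
    e + length Z                         ≤⟨ boundary≥ Z-unique Z⊆ Z-free ⟩
    length (boundary A)                  ≤⟨ boundary≤even min e (suc k) size ⟩
    e + (suc (suc k) + suc (suc k))      ≡⟨ ℕP.+-identityʳ _ ⟨
    e + (suc (suc k) + suc (suc k)) + 0  ∎))
    where
    open ℕP.≤-Reasoning
    arith : ∀ e k → e + (suc (suc k) + suc (suc k)) + k ≡ e + (suc k + (suc (suc k) + suc k))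
    arith = ℕSolver.solve-∀

  tight : length (boundary A) ≤ e + length Z
  tight = ℕP.≤-trans (boundary≤even min e (suc k) size) (ℕP.+-monoʳ-≤ e (ℕP.≤-trans (ℕP.m≤m+n _ k)
    (ℕP.≤-reflexive (trans (arith k) (sym length-Z)))))
    where
    arith : ∀ k → suc (suc k) + suc (suc k) + k ≡ suc k + (suc (suc k) + suc k)
    arith = ℕSolver.solve-∀

  covered : ∀ {p} → p ∈ closure A → p ∈ Z ⊎ ∃[ q ] (q ∈ A × Hit p q)
  covered = tight⇒covered Z-unique Z⊆ Z-free tight

  -- For `k ≡ 0` every nonempty row has the largest size, so `isolated` forbids points of `A` in
  -- adjacent rows. In particular no point of `A` is hit by the shift.
  rowSize≡ : ∀ {p r} → p ∈ A → row p ≡ r → rowSize A r ≡ suc k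
  rowSize≡ {r = r} p∈ eq = ℕP.≤-antisym (bound r)
    (subst (λ k → suc k ≤ rowSize A r) (sym k≡0) (∈⇒0<length (∈-rowOf⁺ p∈ eq)))

  nonadjacent : ∀ {p q} → p ∈ A → q ∈ A → row q ≢ row p ℤ.+ + 1
  nonadjacent p∈ q∈ eq = isolated p∈ (rowSize≡ p∈ refl) (rowSize≡ q∈ eq)

  ¬hit : ∀ {p q} → p ∈ A → q ∈ A → ¬ Hit p q
  ¬hit {p} {q} p∈ q∈ hit with hit⇒row hit
  ... | inj₁ (_ , eq) = nonadjacent p∈ q∈ (sym (trans (cong (ℤ._+ + 1) eq) ([i-1]+1 (row q))))
  ... | inj₂ (_ , eq) = nonadjacent q∈ p∈ eq

  singleton : ∀ {r p q} → rowSize A r ≡ suc k → p ∈ rowOf A r → q ∈ rowOf A r → p ≡ q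
  singleton eq = length≡1⇒≡ (trans eq (cong suc k≡0))

  ∈-cap⁻ : ∀ {p} → p ∈ cap A c → p ≡ up⁺ c ⊎ p ≡ up c
  ∈-cap⁻ (here eq) = inj₁ eq
  ∈-cap⁻ (there p∈) with ∈-map⁻ up p∈
  ... | q , q∈ , refl = inj₂ (cong up (singleton size-c q∈ (∈-rowOf⁺ (proj₁ end) refl)))

  module _ {d : Pt} (d∈s : d ∈ rowOf A s) where

    private
      d∈ = proj₁ (∈-rowOf⁻ A d∈s)
      row-d = proj₂ (∈-rowOf⁻ A d∈s)

    -- Nothing is shifted into row s - 1: downward shifts stay below row t, and an upward shift
    -- would start inside the gap. Since s - 1 is neither t nor s, only the cap remains.
    lower∈cap : ∀ {p} → row p ≡ s - + 1 → p ∈ neighbours d → p ∈ cap A c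
    lower∈cap {p} row-p p∈ = locate (covered (neighbours⊆closure d∈ p∈))
      where
      above : ∀ {q} → q ∈ A → Hit p q → p ∈ cap A c
      above q∈ hit with hit⇒row hit
      ... | inj₁ (q≤t , eq) = contradiction (trans (sym row-p) eq) (≢i-1 (ℤP.≤-trans q≤t (i≤j-1 c<s)))
      ... | inj₂ (t<q , eq) = contradiction (ℤP.<-trans (i<i+1 _)
              (subst (ℤ._< s) (trans (sym row-p) eq) (i-1<i s))) (empty q∈ t<q)
      locate : p ∈ Z ⊎ ∃[ q ] (q ∈ A × Hit p q) → p ∈ cap A c
      locate (inj₂ (_ , q∈ , hit)) = above q∈ hit
      locate (inj₁ p∈Z) with ∈-Z⁻ p∈Z
      ... | inj₁ p∈t = contradiction c+1<s (ℤP.<-irrefl (trans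
              (cong (ℤ._+ + 1) (trans (sym (proj₂ (∈-rowOf⁻ A p∈t))) row-p)) ([i-1]+1 s)))
      ... | inj₂ (inj₁ p∈cap) = p∈cap
      ... | inj₂ (inj₂ p∈s) = contradiction (trans (sym (proj₂ (∈-rowOf⁻ A p∈s))) row-p) (≢i-1 ℤP.≤-refl)

    -- Both lower neighbours of `d` lie in the cap, which consists of `up c` and `up⁺ c` only.
    -- Comparing abscissae excludes every matching in which `down d` is not `up c`.
    d≡ : d ≡ up (up⁺ c)
    d≡ = locate
      (∈-cap⁻ (lower∈cap (trans (row-down d) (cong (_- + 1) row-d)) (there (there (there (here refl))))))
      (∈-cap⁻ (lower∈cap (trans (row-down⁺ d) (cong (_- + 1) row-d)) (here refl)))
      where
      open ℤP.≤-Reasoning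
      locate : down d ≡ up⁺ c ⊎ down d ≡ up c → down⁺ d ≡ up⁺ c ⊎ down⁺ d ≡ up c → d ≡ up (up⁺ c)
      locate (inj₂ eq) _ = trans (sym (up⁺-down d)) (cong up⁺ eq)
      locate (inj₁ eq) (inj₁ eq⁺) = contradiction (cong proj₁ (trans eq (sym eq⁺))) (≢i+1 ℤP.≤-refl)
      locate (inj₁ eq) (inj₂ eq⁺) = contradiction (i<i+1 (proj₁ d)) (ℤP.<-asym (begin-strict
        proj₁ d ℤ.+ + 1     ≡⟨ cong proj₁ eq⁺ ⟩
        proj₁ c - + 1       <⟨ i-1<i _ ⟩
        proj₁ c             ≡⟨ cong proj₁ eq ⟨
        proj₁ d             ∎))

    only : ∀ {p} → p ∈ A → p ≡ c ⊎ p ≡ up (up⁺ c)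
    only {p} p∈ = locate (covered (∈-++⁺ˡ p∈))
      where
      locate : p ∈ Z ⊎ ∃[ q ] (q ∈ A × Hit p q) → p ≡ c ⊎ p ≡ up (up⁺ c)
      locate (inj₂ (_ , q∈ , hit)) = contradiction hit (¬hit p∈ q∈)
      locate (inj₁ p∈Z) with ∈-Z⁻ p∈Z
      ... | inj₁ p∈t = inj₁ (singleton size-c p∈t (∈-rowOf⁺ (proj₁ end) refl))
      ... | inj₂ (inj₁ p∈cap) = contradiction (row-cap uA end p∈cap) (nonadjacent (proj₁ end) p∈)
      ... | inj₂ (inj₂ p∈s) = inj₂ (trans (singleton size-s p∈s d∈s) d≡)

    congruent : Congruent A B02
    congruent = antidiagonal⇒congruent c (proj₁ end) (subst (_∈ A) d≡ d∈) only

-- Every minimal set has the row structure or is exceptional.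

module _ {A : List Pt} (min : Minimal A) {k : ℕ} (bound : ∀ r → rowSize A r ≤ suc k) where

  private
    uA = proj₁ (proj₂ min)
    e = length (ends A)

  Twin : Pt → Set
  Twin q = rowSize A (row q) ≡ suc k × rowSize A (row q ℤ.+ + 1) ≡ suc k

  row-nonempty : ∀ {r} → rowSize A r ≡ suc k → ∃[ c ] (RightEnd A c × row c ≡ r)
  row-nonempty {r} size =
    let q , q∈ = 0<length⇒∈ {xs = rowOf A r} (subst (0 <_) (sym size) (s≤s z≤n))
        q∈A , row-q = ∈-rowOf⁻ A q∈
        c , end , row-c = rightEnd q∈A
    in c , end , trans row-c row-q

  -- The cap of the lower row and the floor of the upper one fill the two free rows with 2m + 2
  -- points, m = `suc k`, which is sharp against `boundary≤even`.
  twin⇒rowStructure : ∀ {q} → Twin q → length A ≤ suc k * e → RowStructure A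
  twin⇒rowStructure {q} (size-q , size-q+1) size = build (row-nonempty size-q) (row-nonempty size-q+1)
    where
    build : ∃[ c ] (RightEnd A c × row c ≡ row q) → ∃[ d ] (RightEnd A d × row d ≡ row q ℤ.+ + 1) → RowStructure A
    build (c , end , row-c) (d , end′ , row-d) =
      tight⇒rowStructure uA end (floor-unique uA end′) (floor⊆closure uA end′) row-floor≡
        (subst (λ l → length (boundary A) ≤ e + l) (sym len) (boundary≤even min e (suc k) size))
      where
      row-floor≡ : ∀ {r} → r ∈ floor A d → row r ≡ row c
      row-floor≡ r∈ = trans (row-floor uA end′ r∈) (trans (cong (_- + 1) row-d) (trans ([i+1]-1 (row q)) (sym row-c)))
      len : length (floor A d ++ cap A c) ≡ suc (suc k) + suc (suc k)
      len = trans (LP.length-++ (floor A d)) (cong₂ _+_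
        (trans (length-floor A d) (cong suc (trans (cong (rowSize A) row-d) size-q+1)))
        (trans (length-cap A c) (cong suc (trans (cong (rowSize A) row-c) size-q))))

  gap⇒congruent : (∀ {q} → q ∈ A → ¬ Twin q) → length A ≤ suc k * e → Gap A (suc k) → Congruent A B02
  gap⇒congruent ¬twin size (mkGap {r} {s} r<s size-r size-s empty) =
    build (row-nonempty size-r) (0<length⇒∈ (subst (0 <_) (sym size-s) (s≤s z≤n)))
    where
    build : ∃[ c ] (RightEnd A c × row c ≡ r) → ∃[ d ] d ∈ rowOf A s → Congruent A B02
    build (c , end , refl) (d , d∈) =
      Separated.congruent min bound size (λ q∈ eq₁ eq₂ → ¬twin q∈ (eq₁ , eq₂)) r<s end size-r size-s empty d∈

  -- Here the largest row itself serves as `X`. With its cap it supplies m + (m + 1) points, m =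
  -- `suc k`, which is sharp against `boundary≤odd`.
  sparse⇒rowStructure : ∀ {p} → p ∈ A → rowSize A (row p) ≡ suc k →
    2 * length A ≤ suc (suc (2 * k) * e) → RowStructure A
  sparse⇒rowStructure {p} p∈ size-p le = build (rightEnd p∈)
    where
    build : ∃[ c ] (RightEnd A c × row c ≡ row p) → RowStructure A
    build (c , end , row-c) = tight⇒rowStructure uA end (UP.filter⁺ _ uA)
      (λ q∈ → ∈-++⁺ˡ (proj₁ (∈-rowOf⁻ A q∈))) (λ q∈ → proj₂ (∈-rowOf⁻ A q∈))
      (subst (λ l → length (boundary A) ≤ e + l) (sym len) (boundary≤odd min e k le))
      where
      size-c : rowSize A (row c) ≡ suc k
      size-c = trans (cong (rowSize A) row-c) size-p
      len : length (rowOf A (row c) ++ cap A c) ≡ suc k + suc (suc k)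
      len = trans (LP.length-++ (rowOf A (row c))) (cong₂ _+_ size-c (trans (length-cap A c) (cong suc size-c)))

  -- Adjacent largest rows are sought first, since they too could form a `Gap`. Once they are
  -- excluded, a gap gives the exceptional pair, and its absence gives the sharper count.
  largest⇒rowStructure : ∀ {p} → p ∈ A → rowSize A (row p) ≡ suc k → RowStructure A ⊎ Congruent A B02
  largest⇒rowStructure {p} p∈ size-p = decide (Any.any? twin? A) (rowSize-sum p∈ bound)
    where
    twin? : ∀ q → Dec (Twin q)
    twin? q = (rowSize A (row q) ℕP.≟ suc k) ×-dec (rowSize A (row q ℤ.+ + 1) ℕP.≟ suc k)
    decide : Dec (Any.Any Twin A) →
      length A ≤ suc k * e × (Gap A (suc k) ⊎ 2 * length A ≤ suc (suc (2 * k) * e)) → RowStructure A ⊎ Congruent A B02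
    decide (yes twins) (size , _) = let q , _ , twin = find twins in inj₁ (twin⇒rowStructure {q} twin size)
    decide (no ¬twins) (size , inj₁ gap) = inj₂ (gap⇒congruent (λ q∈ twin → ¬twins (lose q∈ twin)) size gap)
    decide (no ¬twins) (_ , inj₂ le) = inj₁ (sparse⇒rowStructure p∈ size-p le)

minimal⇒rowStructure : ∀ {A} → Minimal A → RowStructure A ⊎ Congruent A B02
minimal⇒rowStructure {[]} (nonempty , _) = contradiction refl nonempty
minimal⇒rowStructure {A@(z ∷ _)} min = build (maximiser (λ p → + rowSize A (row p)) {z = z} (here refl))
  where
  build : ∃[ p ] (p ∈ A × ∀ {q} → q ∈ A → + rowSize A (row q) ℤ.≤ + rowSize A (row p)) →
          RowStructure A ⊎ Congruent A B02
  build (p , p∈ , largest) = split (rowSize A (row p)) refl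
    where
    bound : ∀ r → rowSize A r ≤ rowSize A (row p)
    bound r with rowSize A r ℕP.≤? rowSize A (row p)
    ... | yes le = le
    ... | no ≰ =
      let q , q∈ = 0<length⇒∈ {xs = rowOf A r} (ℕP.≤-<-trans z≤n (ℕP.≰⇒> ≰))
          q∈A , row-q = ∈-rowOf⁻ A q∈
      in contradiction (subst (λ r → rowSize A r ≤ rowSize A (row p)) row-q (ℤP.drop‿+≤+ (largest q∈A))) ≰
    split : ∀ m → rowSize A (row p) ≡ m → RowStructure A ⊎ Congruent A B02
    split zero eq = contradiction (sym eq) (ℕP.<⇒≢ (∈⇒0<length (∈-rowOf⁺ p∈ refl)))
    split (suc k) eq = largest⇒rowStructure min (λ r → subst (rowSize A r ≤_) eq (bound r)) p∈ eq

-- Paths and connectedness.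

Adj-sym : ∀ p q → Adj p q → Adj q p
Adj-sym (x , y) (x′ , y′) adj = trans (cong₂ _+_ (ℤP.∣i-j∣≡∣j-i∣ x′ x) (ℤP.∣i-j∣≡∣j-i∣ y′ y)) adj

neighbour⇒Adj : ∀ {p q} → q ∈ neighbours p → Adj p q
neighbour⇒Adj {x , y} = λ where
    (here refl) → cong₂ _+_ (cong ∣_∣ (e₁ x)) (cong ∣_∣ (e₀ y))
    (there (here refl)) → cong₂ _+_ (cong ∣_∣ (e₂ x)) (cong ∣_∣ (e₀ y))
    (there (there (here refl))) → cong₂ _+_ (cong ∣_∣ (e₀ x)) (cong ∣_∣ (e₁ y))
    (there (there (there (here refl)))) → cong₂ _+_ (cong ∣_∣ (e₀ x)) (cong ∣_∣ (e₂ y))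
  where
  e₀ : ∀ x → x - x ≡ + 0
  e₀ = solve-∀
  e₁ : ∀ x → x - (x ℤ.+ + 1) ≡ - + 1
  e₁ = solve-∀
  e₂ : ∀ x → x - (x - + 1) ≡ + 1
  e₂ = solve-∀

module _ {A : List Pt} where

  path-trans : ∀ {u v w} → PathIn A u v → PathIn A v w → PathIn A u w
  path-trans here q = q
  path-trans (step adj v∈ p) q = step adj v∈ (path-trans p q)

  path-sym : ∀ {u v} → u ∈ A → PathIn A u v → PathIn A v u
  path-sym u∈ here = here
  path-sym {u} u∈ (step {w = w} adj w∈ p) = path-trans (path-sym w∈ p) (step (Adj-sym u w adj) u∈ here)

  path-step : ∀ {p q} → q ∈ neighbours p → q ∈ A → PathIn A p q
  path-step q∈n q∈ = step (neighbour⇒Adj q∈n) q∈ here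

i≤j⇒i+n≡j : ∀ {i j} → i ℤ.≤ j → ∃[ n ] (i ℤ.+ + n ≡ j)
i≤j⇒i+n≡j {i} {j} i≤j = ∣ i - j ∣ , trans (cong (λ d → i ℤ.+ d) (ℤP.∣-∣-≤ i≤j)) (eq i j)
  where
  eq : ∀ i j → i ℤ.+ (j - i) ≡ j
  eq = solve-∀

i+suc : ∀ i n → i ℤ.+ + suc n ≡ i ℤ.+ + 1 ℤ.+ + n
i+suc i n = sym (ℤP.+-assoc i (+ 1) (+ n))

i<i+suc : ∀ i n → i ℤ.< i ℤ.+ + suc n
i<i+suc i n = ℤP.<-≤-trans (i<i+1 i) (subst (i ℤ.+ + 1 ℤ.≤_) (sym (i+suc i n)) (ℤP.i≤i+j _ (+ n)))

-- Two consecutive points p, diag p of a row have a common neighbour in A: one of them is not on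
-- the far side of the peak column, so it has a neighbour in the column between them.
reflected⇒common : ∀ {A} → RowStructure (map reflect A) → ∀ {p} → p ∈ A → diag p ∈ A → down⁺ p ∈ A ⊎ up⁺ p ∈ A
reflected⇒common {A} cols {p} p∈ d∈ = case-split (row (reflect p) ℤP.<? row peak)
  where
  open RowStructure cols
  ∈-reflect⁻ : ∀ {q r} → r ∈ map reflect A → r ≡ reflect q → q ∈ A
  ∈-reflect⁻ r∈ eq with ∈-map⁻ reflect r∈
  ... | a , a∈ , eq′ = subst (_∈ A) (reflect-injective (trans (sym eq′) eq)) a∈
  up-reflect : ∀ q → up (reflect q) ≡ reflect (down⁺ q)
  up-reflect (x , y) = cong (_, y) (sym (ℤP.neg-distrib-+ x (+ 1)))
  down⁺-reflect : ∀ q → down⁺ (reflect q) ≡ reflect (up q)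
  down⁺-reflect (x , y) = cong (_, y) (sym (ℤP.neg-distrib-+ x (- + 1)))
  later : row (reflect p) ℤ.< row (reflect (diag p))
  later = subst (row (reflect p) ℤ.<_) (eq (proj₁ p) (proj₂ p)) (ℤP.<-trans (i<i+1 _) (i<i+1 _))
    where
    eq : ∀ x y → y - - x ℤ.+ + 1 ℤ.+ + 1 ≡ y ℤ.+ + 1 - - (x ℤ.+ + 1)
    eq = solve-∀
  case-split : Dec (row (reflect p) ℤ.< row peak) → down⁺ p ∈ A ⊎ up⁺ p ∈ A
  case-split (yes lt) with ascend (∈-map⁺ reflect p∈) lt
  ... | inj₁ u∈ = inj₁ (∈-reflect⁻ u∈ (up-reflect p))
  ... | inj₂ u∈ = inj₂ (∈-reflect⁻ u∈ refl)
  case-split (no ≮) with descend (∈-map⁺ reflect d∈) (ℤP.≤-<-trans (ℤP.≮⇒≥ ≮) later)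
  ... | inj₁ u∈ = inj₁ (subst (_∈ A) (down-diag p) (∈-reflect⁻ {down (diag p)} u∈ refl))
  ... | inj₂ u∈ = inj₂ (subst (_∈ A) (up-diag p) (∈-reflect⁻ u∈ (down⁺-reflect (diag p))))

rowStructures⇒connected : ∀ {A} → RowStructure A → RowStructure (map reflect A) → Connected A
rowStructures⇒connected {A} rows cols u v u∈ v∈ = path-trans (to-peak u∈) (path-sym v∈ (to-peak v∈))
  where
  open RowStructure rows
  t = row peak

  link : ∀ {p} → p ∈ A → diag p ∈ A → PathIn A p (diag p)
  link p∈ d∈ with reflected⇒common cols p∈ d∈
  ... | inj₁ q∈ = path-trans (path-step (here refl) q∈) (path-step (there (there (here refl))) d∈)
  ... | inj₂ q∈ = path-trans (path-step (there (there (here refl))) q∈) (path-step (here refl) d∈)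

  along-path : ∀ n {p} → p ∈ A → row p ≡ t → proj₁ p ℤ.+ + n ≡ proj₁ peak → PathIn A p peak
  along-path n {p} p∈ eq dist with proj₂ (along p∈ eq)
  ... | inj₁ refl = here
  -- At distance zero from the abscissa of `peak`, the point `diag p` would lie beyond the right end
  -- of the peak row.
  along-path zero {p} p∈ eq dist | inj₂ d∈ = contradiction
    (proj₁ (along d∈ (trans (row-diag p) eq)))
    (ℤP.<⇒≱ (subst (ℤ._< proj₁ p ℤ.+ + 1) (trans (sym (ℤP.+-identityʳ (proj₁ p))) dist) (i<i+1 (proj₁ p))))
  along-path (suc n) {p} p∈ eq dist | inj₂ d∈ = path-trans (link p∈ d∈)
    (along-path n d∈ (trans (row-diag p) eq) (trans (sym (i+suc (proj₁ p) n)) dist))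

  in-row : ∀ {p} → p ∈ A → row p ≡ t → PathIn A p peak
  in-row p∈ eq = let n , dist = i≤j⇒i+n≡j (proj₁ (along p∈ eq)) in along-path n p∈ eq dist

  ascend-path : ∀ n {p} → p ∈ A → row p ℤ.+ + n ≡ t → PathIn A p peak
  ascend-path zero p∈ dist = in-row p∈ (trans (sym (ℤP.+-identityʳ _)) dist)
  ascend-path (suc n) {p} p∈ dist with ascend p∈ (subst (row p ℤ.<_) dist (i<i+suc (row p) n))
  ... | inj₁ q∈ = path-trans (path-step (there (here refl)) q∈) (ascend-path n q∈
          (trans (cong (ℤ._+ + n) (row-up p)) (trans (sym (i+suc (row p) n)) dist)))
  ... | inj₂ q∈ = path-trans (path-step (there (there (here refl))) q∈) (ascend-path n q∈
          (trans (cong (ℤ._+ + n) (row-up⁺ p)) (trans (sym (i+suc (row p) n)) dist)))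

  descend-path : ∀ n {p} → p ∈ A → t ℤ.+ + n ≡ row p → PathIn A p peak
  descend-path zero p∈ dist = in-row p∈ (trans (sym dist) (ℤP.+-identityʳ _))
  descend-path (suc n) {p} p∈ dist = [ lower (row-down p) (there (there (there (here refl)))) , lower (row-down⁺ p) (here refl) ]′
      (descend p∈ (subst (t ℤ.<_) dist (i<i+suc t n)))
    where
    eq : ∀ t n → t ℤ.+ (+ 1 ℤ.+ n) - + 1 ≡ t ℤ.+ n
    eq = solve-∀
    lower : ∀ {q} → row q ≡ row p - + 1 → q ∈ neighbours p → q ∈ A → PathIn A p peak
    lower row-q q∈n q∈ = path-trans (path-step q∈n q∈) (descend-path n q∈
      (sym (trans row-q (trans (cong (_- + 1) (sym dist)) (eq t (+ n))))))

  to-peak : ∀ {p} → p ∈ A → PathIn A p peak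
  to-peak {p} p∈ with ℤP.≤-total (row p) t
  ... | inj₁ le = let n , dist = i≤j⇒i+n≡j le in ascend-path n p∈ dist
  ... | inj₂ ge = let n , dist = i≤j⇒i+n≡j ge in descend-path n p∈ dist

-- The origin has no neighbour in `B02`, so no path in `A` leaves its preimage.
connected⇒¬congruent : ∀ {A} → Connected A → ¬ Congruent A B02
connected⇒¬congruent {A} conn (f , (_ , adj) , into , onto)
  with onto _ (here refl) | onto _ (there (here refl))
... | a , a∈ , fa | b , b∈ , fb = impossible (conn a b a∈ b∈)
  where
  isolated : ∀ {q} → q ∈ B02 → ¬ Adj (+ 0 , + 0) q
  isolated (here refl) ()
  isolated (there (here refl)) ()
  impossible : ¬ PathIn A a b
  impossible here = contradiction (trans (sym fa) fb) λ ()
  impossible (step {w = w} adj-aw w∈ _) =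
    isolated (into w w∈) (subst (λ p → Adj p (f w)) fa (Equivalence.to (adj a w) adj-aw))

theorem7p1 : (A : List Pt) → Minimal A → (Connected A ⇔ (¬ Congruent A B02))
theorem7p1 A min = mk⇔ connected⇒¬congruent λ ¬cong →
  rowStructures⇒connected
    ([ id , (λ cong → contradiction cong ¬cong) ]′ (minimal⇒rowStructure min))
    -- The rows of the mirror image are the columns of `A`, and if the mirror image is exceptional,
    -- so is `A`.
    ([ id , (λ cong → contradiction (congruent-reflect cong) ¬cong) ]′ (minimal⇒rowStructure (minimal-reflect min)))
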